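{- Let $M$ be a simple regular matroid and let $A$ be a $g\times n$ totally unimodular real matrix with columns $v_1,\dots,v_n$ whose column matroid is $M$. Let $\sigma_A = \mathbb{R}_{>0}\langle v_1v_1^T,\dots,v_nv_n^T\rangle$, an open cone in the space of $g\times g$ real symmetric matrices, and let $\mathrm{Stab}(\sigma_A) = \{X \in GL_g(\mathbb{Z}) : X^T\sigma_A X = \sigma_A\}$. Each $X \in \mathrm{Stab}(\sigma_A)$ permutes the rays of the closure $\overline{\sigma_A}$ via $Q \mapsto X^TQX$; let $H$ be the group of permutations of the rays of $\overline{\sigma_A}$ realized in this way by elements of $\mathrm{Stab}(\sigma_A)$. Then $H \cong \mathrm{Aut}(M)$.
   Context: A matroid is simple if it has no loops and no parallel elements. A matrix is totally unimodular if every square submatrix has determinant in $\{0,1,-1\}$; a matroid is regular if it is representable over $\mathbb{R}$ by a totally unimodular matrix. The rays of $\overline{\sigma_A}$ are the rays $\mathbb{R}_{\geq 0}v_iv_i^T$, one for each column. $\mathrm{Aut}(M)$ is the group of permutations of the ground set of $M$ preserving independent sets.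
   Formalization: The cone σ_A, the condition X^Tσ_A X = σ_A, the scalars on rays and linear independence of columns are taken over the rationals instead of the reals; A, being totally unimodular, is given as an integer matrix. -}

module Defs where

open import Data.Nat using (ℕ; zero; suc)
open import Data.Fin using (Fin; zero; suc; punchIn; _≟_)
open import Relation.Nullary using (yes; no)
open import Data.Fin.Permutation using (Permutation′; _⟨$⟩ʳ_; _⟨$⟩ˡ_; _∘ₚ_)
open import Data.Bool using (Bool; true; false)
open import Data.Integer as ℤ using (ℤ)
open import Data.Rational as ℚ using (ℚ; 0ℚ; _<_)
open import Data.Product using (Σ; ∃; _×_; _,_; proj₁)
open import Data.Sum using (_⊎_)
open import Relation.Binary.PropositionalEquality using (_≡_; _≢_)
open import Function.Definitions using (Injective)
open import Function.Bundles using (_⇔_)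

Mat : Set → ℕ → ℕ → Set
Mat A m n = Fin m → Fin n → A

Σℤ : ∀ {n} → (Fin n → ℤ) → ℤ
Σℤ {zero}  f = ℤ.0ℤ
Σℤ {suc n} f = f zero ℤ.+ Σℤ (λ i → f (suc i))

Σℚ : ∀ {n} → (Fin n → ℚ) → ℚ
Σℚ {zero}  f = 0ℚ
Σℚ {suc n} f = f zero ℚ.+ Σℚ (λ i → f (suc i))

det : ∀ {k} → Mat ℤ k k → ℤ
det {zero}  M = ℤ.1ℤ
det {suc k} M = go M
  where
  sgn : ∀ {m} → Fin m → ℤ
  sgn zero    = ℤ.1ℤ
  sgn (suc i) = ℤ.- sgn i
  go : Mat ℤ (suc k) (suc k) → ℤ
  go M = Σℤ (λ j → sgn j ℤ.* (M zero j ℤ.* det (λ a b → M (suc a) (punchIn j b))))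

-- Totally unimodular: every square submatrix has determinant 0, 1 or -1.
-- (Submatrices are selected by injective row/column maps; reordering only
-- changes the sign of the determinant.)
TotallyUnimodular : ∀ {g n} → Mat ℤ g n → Set
TotallyUnimodular {g} {n} A =
  ∀ k (r : Fin k → Fin g) (c : Fin k → Fin n) →
  Injective _≡_ _≡_ r → Injective _≡_ _≡_ c →
  let d = det (λ a b → A (r a) (c b)) in
  (d ≡ ℤ.0ℤ) ⊎ (d ≡ ℤ.1ℤ) ⊎ (d ≡ ℤ.-1ℤ)

toℚ : ℤ → ℚ
toℚ z = z ℚ./ 1

-- Column matroid of A: a subset S of the columns is independent iff the
-- columns in S are linearly independent (over ℚ, equivalently over ℝ since
-- A has integer entries).
Independent : ∀ {g n} → Mat ℤ g n → (Fin n → Bool) → Set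
Independent {g} {n} A S =
  ∀ (c : Fin n → ℚ) → (∀ i → S i ≡ false → c i ≡ 0ℚ) →
  (∀ a → Σℚ (λ i → c i ℚ.* toℚ (A a i)) ≡ 0ℚ) → ∀ i → c i ≡ 0ℚ

singleton : ∀ {n} → Fin n → Fin n → Bool
singleton i j with i ≟ j
... | yes _ = true
... | no  _ = false

pair : ∀ {n} → Fin n → Fin n → Fin n → Bool
pair i j k with i ≟ k | j ≟ k
... | no _ | no _ = false
... | _ | _ = true

Simple : ∀ {g n} → Mat ℤ g n → Set
Simple {g} {n} A =
  (∀ i → Independent A (singleton i)) ×
  (∀ i j → i ≢ j → Independent A (pair i j))

image : ∀ {n} → Permutation′ n → (Fin n → Bool) → (Fin n → Bool)
image π S j = S (π ⟨$⟩ˡ j)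

IsAut : ∀ {g n} → Mat ℤ g n → Permutation′ n → Set
IsAut A π = ∀ S → Independent A S ⇔ Independent A (image π S)

_·_ : ∀ {a b c} → Mat ℚ a b → Mat ℚ b c → Mat ℚ a c
(M · N) i k = Σℚ (λ j → M i j ℚ.* N j k)

_ᵀ : ∀ {a b} → Mat ℚ a b → Mat ℚ b a
(M ᵀ) i j = M j i

toℚMat : ∀ {a b} → Mat ℤ a b → Mat ℚ a b
toℚMat M i j = toℚ (M i j)

rankOne : ∀ {g n} → Mat ℤ g n → Fin n → Mat ℚ g g
rankOne A i a b = toℚ (A a i) ℚ.* toℚ (A b i)

InCone : ∀ {g n} → Mat ℤ g n → Mat ℚ g g → Set
InCone {g} {n} A Q =
  Σ (Fin n → ℚ) λ λs → (∀ i → 0ℚ < λs i) ×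
    (∀ a b → Q a b ≡ Σℚ (λ i → λs i ℚ.* rankOne A i a b))

_·ℤ_ : ∀ {a b c} → Mat ℤ a b → Mat ℤ b c → Mat ℤ a c
(M ·ℤ N) i k = Σℤ (λ j → M i j ℤ.* N j k)

idℤ : ∀ {g} → Mat ℤ g g
idℤ i j with i ≟ j
... | yes _ = ℤ.1ℤ
... | no  _ = ℤ.0ℤ

GLℤ : ∀ {g} → Mat ℤ g g → Set
GLℤ {g} X = Σ (Mat ℤ g g) λ Y → (∀ i j → (X ·ℤ Y) i j ≡ idℤ i j) × (∀ i j → (Y ·ℤ X) i j ≡ idℤ i j)

congr : ∀ {g} → Mat ℤ g g → Mat ℚ g g → Mat ℚ g g
congr X Q = (((toℚMat X) ᵀ) · Q) · toℚMat X

InStab : ∀ {g n} → Mat ℤ g n → Mat ℤ g g → Set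
InStab {g} A X = GLℤ X ×
  ((∀ Q → InCone A Q → InCone A (congr X Q)) ×
   (∀ P → InCone A P → Σ (Mat ℚ g g) λ Q → InCone A Q × (∀ a b → congr X Q a b ≡ P a b)))

-- X induces the permutation π of the rays R_{≥0} v_i v_i^T (indexed by
-- columns): X^T (v_i v_i^T) X lies on the ray of v_{π i} v_{π i}^T.
Realizes : ∀ {g n} → Mat ℤ g n → Mat ℤ g g → Permutation′ n → Set
Realizes A X π = ∀ i → Σ ℚ λ c → 0ℚ < c ×
  (∀ a b → congr X (rankOne A i) a b ≡ c ℚ.* rankOne A (π ⟨$⟩ʳ i) a b)

InH : ∀ {g n} → Mat ℤ g n → Permutation′ n → Set
InH {g} {n} A π = Σ (Mat ℤ g g) λ X → InStab {g} {n} A X × Realizes A X π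

_≈ₚ_ : ∀ {n} → Permutation′ n → Permutation′ n → Set
π ≈ₚ ρ = ∀ i → π ⟨$⟩ʳ i ≡ ρ ⟨$⟩ʳ i

GroupIso : ∀ {n} → (Permutation′ n → Set) → (Permutation′ n → Set) → Set
GroupIso {n} P Q =
  Σ (Σ (Permutation′ n) P → Σ (Permutation′ n) Q) λ f →
    (∀ x y → proj₁ x ≈ₚ proj₁ y → proj₁ (f x) ≈ₚ proj₁ (f y)) ×
    (∀ x y → proj₁ (f x) ≈ₚ proj₁ (f y) → proj₁ x ≈ₚ proj₁ y) ×
    (∀ (z : Σ (Permutation′ n) Q) → Σ (Σ (Permutation′ n) P) λ x → proj₁ (f x) ≈ₚ proj₁ z) ×
    (∀ x y z → (proj₁ x ∘ₚ proj₁ y) ≈ₚ proj₁ z →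
               (proj₁ (f x) ∘ₚ proj₁ (f y)) ≈ₚ proj₁ (f z))

{-# OPTIONS --safe #-}
module Submission where

-- A matrix X in Stab(σ_A) satisfies Xᵀ vᵢ = δᵢ v_{π i} with δᵢ ≠ 0, because a rank-one matrix w wᵀ
-- determines w up to a scalar; as X is invertible, π preserves linear independence.  Conversely,
-- for π in Aut(M) the matrices A and A ∘ π are totally unimodular representations of the same
-- matroid.  In a common basis their coordinate matrices have entries 0, ±1 and equal supports,
-- and so do all their pivots; this forces them to agree up to signs of rows and columns (Camion).
-- Hence vᵢ ↦ ± v_{π i} extends to the lattice spanned by the columns, which is a direct
-- summand of ℤ^g because the bases have unimodular minors, and so to an element of GL_g(ℤ).

open import Defs
open import Data.Nat using (ℕ)
open import Data.Integer using (ℤ)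
open import Algebra.Bundles using (CommutativeRing)
import Algebra.Properties.Semiring.Sum as Sum
open import Data.Bool using (Bool; true; false)
open import Data.Fin using (Fin; zero; suc; punchIn; punchOut; pinch; _≟_)
import Data.Fin.Permutation as Perm
open import Data.Fin.Permutation using (Permutation′; _⟨$⟩ʳ_; _⟨$⟩ˡ_; _∘ₚ_; inverseˡ; inverseʳ; transpose; flip)
import Data.Fin.Permutation.Components as Components
open import Data.Fin.Properties using (suc-injective; punchInᵢ≢i; punchIn-punchOut; any?; all?; ¬∀⟶∃¬)
open import Data.Integer as ℤ using (0ℤ; 1ℤ; -1ℤ; _+_; _*_; -_; _-_)
import Data.Integer.Properties as ℤ
open import Data.Integer.Tactic.RingSolver using (solve-∀)
open import Data.List as List using (List; []; allFin)
open import Data.List.Membership.Propositional using (_∈_)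
open import Data.List.Membership.Propositional.Properties using (∈-allFin)
open import Data.List.Relation.Unary.Any using (here; there)
open import Data.Nat as ℕ using (zero; suc)
import Data.Nat.Properties as ℕ
open import Data.Product using (Σ; ∃; _×_; _,_; proj₁; proj₂)
open import Data.Rational as ℚ using (ℚ; 0ℚ; 1ℚ)
import Data.Rational.Properties as ℚ
open import Data.Rational.Solver using (module +-*-Solver)
import Data.Rational.Unnormalised as ℚᵘ
import Data.Rational.Unnormalised.Properties as ℚᵘ
open import Data.Sum using (_⊎_; inj₁; inj₂)
open import Data.Vec.Functional using (_∷_; updateAt)
open import Data.Vec.Functional.Properties using (updateAt-updates; updateAt-minimal)
open import Function using (_∘_; const)
open import Function.Bundles using (mk⇔; Equivalence)
open import Function.Definitions using (Injective)
open import Level using (0ℓ)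
open import Relation.Binary.PropositionalEquality
open import Relation.Nullary using (¬_; Dec; yes; no; contradiction)
open import Relation.Nullary.Decidable using (¬?; _×-dec_; _⊎-dec_; does; dec-true)

-- Finite sums and the Laplace expansion

-- The linear algebra rests on one identity: the signed maximal minors of a `k` by `k + 1` matrix
-- are orthogonal to its rows (`cofactor-kernel`). Total unimodularity makes this vector ternary,
-- and it serves as the candidate dependency when a column is tested against an independent family,
-- as the source of integral coordinates and as Cramer's rule. A pivoted coordinate matrix is
-- ternary because it holds the coordinates of the same columns in another basis. The obstacle in
-- comparing two such matrices is that row signs are determined only on each connected component of
-- the support: a new column may touch a component in several rows, and the signs they demand must
-- agree. Pivots shorten a cycle through the new column to two rows and two columns, where a
-- disagreement would produce an entry 2 or -2. For the extension to the whole lattice, the unit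
-- vectors outside the rows of a unimodular minor span a complement; a permutation of coordinates
-- matches the complements of the two families. Signs do not matter in the end, since a ray only
-- sees the product of a vector with its own transpose.

module FiniteSum (R : CommutativeRing 0ℓ 0ℓ)
  (∑ : ∀ {n} → (Fin n → CommutativeRing.Carrier R) → CommutativeRing.Carrier R)
  (∑-sum : ∀ {n} (f : Fin n → CommutativeRing.Carrier R) →
    CommutativeRing._≈_ R (∑ f) (Sum.sum (CommutativeRing.semiring R) f)) where
  private
    module R = CommutativeRing R
    open R using (Carrier; _≈_; 0#)
    module S = Sum R.semiring

  ∑-cong : ∀ {n} {f h : Fin n → Carrier} → (∀ i → f i ≈ h i) → ∑ f ≈ ∑ h
  ∑-cong eq = R.trans (∑-sum _) (R.trans (S.sum-cong-≋ eq) (R.sym (∑-sum _)))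

  ∑-distrib-+ : ∀ {n} (f h : Fin n → Carrier) → ∑ (λ i → f i R.+ h i) ≈ ∑ f R.+ ∑ h
  ∑-distrib-+ f h = R.trans (∑-sum _) (R.trans (S.∑-distrib-+ f h)
    (R.sym (R.+-cong (∑-sum f) (∑-sum h))))

  *-distribˡ-∑ : ∀ {n} x (f : Fin n → Carrier) → x R.* ∑ f ≈ ∑ (λ i → x R.* f i)
  *-distribˡ-∑ x f = R.trans (R.*-congˡ (∑-sum f)) (R.trans (S.*-distribˡ-sum x f) (R.sym (∑-sum _)))

  *-distribʳ-∑ : ∀ {n} x (f : Fin n → Carrier) → ∑ f R.* x ≈ ∑ (λ i → f i R.* x)
  *-distribʳ-∑ x f = R.trans (R.*-congʳ (∑-sum f)) (R.trans (S.*-distribʳ-sum x f) (R.sym (∑-sum _)))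

  ∑-comm : ∀ {m n} (f : Fin m → Fin n → Carrier) →
    ∑ (λ i → ∑ (λ j → f i j)) ≈ ∑ (λ j → ∑ (λ i → f i j))
  ∑-comm f = R.trans (double f) (R.trans (S.∑-comm f) (R.sym (double (λ j i → f i j))))
    where
    double : ∀ {m n} (f : Fin m → Fin n → Carrier) →
      ∑ (λ i → ∑ (λ j → f i j)) ≈ S.sum (λ i → S.sum (λ j → f i j))
    double f = R.trans (∑-sum _) (S.sum-cong-≋ (λ i → ∑-sum (f i)))

  ∑-remove : ∀ {n} (i : Fin (suc n)) (f : Fin (suc n) → Carrier) →
    ∑ f ≈ f i R.+ ∑ (f ∘ punchIn i)
  ∑-remove i f = R.trans (∑-sum f) (R.trans (S.sum-remove f) (R.+-congˡ (R.sym (∑-sum _))))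

  ∑-permute : ∀ {n} (f : Fin n → Carrier) (π : Permutation′ n) → ∑ f ≈ ∑ (λ i → f (π ⟨$⟩ʳ i))
  ∑-permute f π = R.trans (∑-sum f) (R.trans (S.sum-permute f π) (R.sym (∑-sum _)))

  ∑-zero : ∀ {n} {f : Fin n → Carrier} → (∀ i → f i ≈ 0#) → ∑ f ≈ 0#
  ∑-zero {n} eq = R.trans (∑-cong eq) (R.trans (∑-sum _) (S.sum-replicate-zero n))

  ∑-single : ∀ {n} {f : Fin n → Carrier} i → (∀ j → j ≢ i → f j ≈ 0#) → ∑ f ≈ f i
  ∑-single {suc n} {f} i eq = R.trans (∑-remove i f)
    (R.trans (R.+-congˡ (∑-zero (λ j → eq (punchIn i j) (punchInᵢ≢i i j)))) (R.+-identityʳ _))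

Σℤ-sum : ∀ {n} (f : Fin n → ℤ) → Σℤ f ≡ Sum.sum (CommutativeRing.semiring ℤ.+-*-commutativeRing) f
Σℤ-sum {zero} f = refl
Σℤ-sum {suc n} f = cong (f zero +_) (Σℤ-sum (f ∘ suc))

Σℚ-sum : ∀ {n} (f : Fin n → ℚ) → Σℚ f ≡ Sum.sum (CommutativeRing.semiring ℚ.+-*-commutativeRing) f
Σℚ-sum {zero} f = refl
Σℚ-sum {suc n} f = cong (f zero ℚ.+_) (Σℚ-sum (f ∘ suc))

module ℤΣ = FiniteSum ℤ.+-*-commutativeRing Σℤ Σℤ-sum
module ℚΣ = FiniteSum ℚ.+-*-commutativeRing Σℚ Σℚ-sum

sgn : ∀ {n} → Fin n → ℤ
sgn zero    = 1ℤ
sgn (suc i) = - sgn i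

minor : ∀ {k} → Mat ℤ k (suc k) → Fin (suc k) → ℤ
minor N j = det (λ a b → N a (punchIn j b))

-- The sign function in the definition of det is local to it and cannot be named.
-- It only occurs in metavariables that Agda solves by unification, and abstracting
-- over negation (and over suc k, on which the local function formally depends)
-- exposes it in a position where unification can do so.  For this the matrix has to
-- be a member of a family, so that its type does not mention suc k.
private
  Family : Set
  Family = ∀ k → Mat ℤ (suc k) (suc k)

  expansion : (f : Family) → ∀ k → Σ (Fin k → ℤ) λ s →
    det (f k) ≡ 1ℤ * (f k zero zero * minor (λ a → f k (suc a)) zero) + Σℤ s
  expansion f k = _ , refl

  mutual
    local-sgn : (f : Family) → ∀ k (j : Fin k) → _ ≡ sgn j

    expansion-term : (f : Family) → ∀ k (j : Fin k) →
      proj₁ (expansion f k) j ≡ sgn (suc j) * (f k zero (suc j) * minor (λ a → f k (suc a)) (suc j))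
    expansion-term f k j with ℤ.-_
    ... | neg = cong (λ z → neg z * (f k zero (suc j) * minor (λ a → f k (suc a)) (suc j)))
                     (local-sgn f k j)

    local-sgn-suc : (f : Family) → ∀ k (j : Fin k) → _ ≡ sgn (suc j)

    -- Here `w` stands for the size on which the local sign formally depends, while `k` only bounds
    -- `j`; with the two roles separated the recursion on `j` closes.
    decoupled-sgn : (f : Family) → ∀ w k (j : Fin k) → _ ≡ sgn j

    local-sgn f (suc k) zero    = refl
    local-sgn f (suc k) (suc j) = local-sgn-suc f k j

    local-sgn-suc f k j with ℤ.-_ | suc k
    ... | neg | w = cong neg (decoupled-sgn f w k j)

    decoupled-sgn f w (suc k) zero    = refl
    decoupled-sgn f w (suc k) (suc j) = cong -_ (decoupled-sgn f w k j)

  extend : ∀ {k} → Mat ℤ (suc k) (suc k) → Family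
  extend {k} M k′ with k ℕ.≟ k′
  ... | yes refl = M
  ... | no _     = λ _ _ → 0ℤ

  extend-self : ∀ {k} (M : Mat ℤ (suc k) (suc k)) → extend M k ≡ M
  extend-self {k} M rewrite ℕ.≟-diag (refl {x = k}) = refl

det-suc : ∀ {k} (M : Mat ℤ (suc k) (suc k)) →
  det M ≡ Σℤ (λ j → sgn j * (M zero j * minor (λ a → M (suc a)) j))
det-suc {k} M = subst
  (λ M → det M ≡ Σℤ (λ j → sgn j * (M zero j * minor (λ a → M (suc a)) j)))
  (extend-self M)
  (trans (proj₂ (expansion (extend M) k))
    (cong (1ℤ * (extend M k zero zero * minor (λ a → extend M k (suc a)) zero) +_)
      (ℤΣ.∑-cong (expansion-term (extend M) k))))

-- Cofactors

det-cong : ∀ {k} {M N : Mat ℤ k k} → (∀ a b → M a b ≡ N a b) → det M ≡ det N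
det-cong {zero} eq = refl
det-cong {suc k} {M} {N} eq = trans (det-suc M) (trans
  (ℤΣ.∑-cong (λ j → cong₂ (λ x y → sgn j * (x * y)) (eq zero j)
    (det-cong (λ a b → eq (suc a) (punchIn j b)))))
  (sym (det-suc N)))

-- The generalised cross product of the rows of `N`; `det-cofactor` pairs it with one further row.
cofactor : ∀ {k} → Mat ℤ k (suc k) → Fin (suc k) → ℤ
cofactor N j = sgn j * minor N j

cofactor-cong : ∀ {k} {M N : Mat ℤ k (suc k)} → (∀ a b → M a b ≡ N a b) → ∀ j → cofactor M j ≡ cofactor N j
cofactor-cong eq j = cong (sgn j *_) (det-cong (λ a b → eq a (punchIn j b)))

det-cofactor : ∀ {k} (M : Mat ℤ (suc k) (suc k)) →
  det M ≡ Σℤ (λ j → cofactor (λ a → M (suc a)) j * M zero j)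
det-cofactor M = trans (det-suc M) (ℤΣ.∑-cong (λ j → lem (sgn j) (M zero j) (minor (λ a → M (suc a)) j)))
  where
  lem : ∀ x y z → x * (y * z) ≡ x * z * y
  lem = solve-∀

-- (j , l) ↦ (punchIn j l , pinch l j) exchanges the two members of the pair of
-- distinct indices j, punchIn j l.
punchIn-pinch : ∀ {n} (j : Fin (suc n)) (l : Fin n) → punchIn (punchIn j l) (pinch l j) ≡ j
punchIn-pinch zero    zero    = refl
punchIn-pinch zero    (suc l) = refl
punchIn-pinch (suc j) zero    = refl
punchIn-pinch (suc j) (suc l) = cong suc (punchIn-pinch j l)

punchIn-punchIn-pinch : ∀ {n} (j : Fin (suc (suc n))) (l : Fin (suc n)) b →
  punchIn (punchIn j l) (punchIn (pinch l j) b) ≡ punchIn j (punchIn l b)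
punchIn-punchIn-pinch zero    l       b       = refl
punchIn-punchIn-pinch (suc j) zero    b       = refl
punchIn-punchIn-pinch (suc j) (suc l) zero    = refl
punchIn-punchIn-pinch (suc j) (suc l) (suc b) = cong suc (punchIn-punchIn-pinch j l b)

-- Both products belong to deleting the same two columns, in opposite orders. Deleting the smaller
-- index first shifts the larger one by one place, which accounts for the minus sign.
sgn-punchIn-pinch : ∀ {n} (j : Fin (suc n)) (l : Fin n) →
  sgn (punchIn j l) * sgn (pinch l j) ≡ - (sgn j * sgn l)
sgn-punchIn-pinch zero    zero    = refl
sgn-punchIn-pinch zero    (suc l) = lem (sgn l)
  where
  lem : ∀ x → - - x * 1ℤ ≡ - (1ℤ * - x)
  lem = solve-∀
sgn-punchIn-pinch (suc j) zero    = lem (sgn j)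
  where
  lem : ∀ x → 1ℤ * x ≡ - (- x * 1ℤ)
  lem = solve-∀
sgn-punchIn-pinch (suc j) (suc l) = begin
  - sgn (punchIn j l) * - sgn (pinch l j) ≡⟨ lem (sgn (punchIn j l)) (sgn (pinch l j)) ⟩
  sgn (punchIn j l) * sgn (pinch l j)     ≡⟨ sgn-punchIn-pinch j l ⟩
  - (sgn j * sgn l)                       ≡⟨ cong -_ (lem (sgn j) (sgn l)) ⟨
  - (- sgn j * - sgn l)                   ∎
  where
  open ≡-Reasoning
  lem : ∀ x y → - x * - y ≡ x * y
  lem = solve-∀

-- The exchange is an involution on ordered pairs of distinct indices. Pairs whose first member is
-- zero trade places with those whose second member is zero; the others form the same sum one size
-- smaller.
∑∑-exchange : ∀ {n} (h : Fin (suc n) → Fin n → ℤ) →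
  Σℤ (λ j → Σℤ (λ l → h j l)) ≡ Σℤ (λ j → Σℤ (λ l → h (punchIn j l) (pinch l j)))
∑∑-exchange {zero}  h = refl
∑∑-exchange {suc n} h = begin
  Σℤ (h zero) + Σℤ (λ j → h (suc j) zero + Σℤ (λ l → h (suc j) (suc l)))
    ≡⟨ cong (Σℤ (h zero) +_) (ℤΣ.∑-distrib-+ (λ j → h (suc j) zero) (λ j → Σℤ (λ l → h (suc j) (suc l)))) ⟩
  Σℤ (h zero) + (Σℤ (λ j → h (suc j) zero) + Σℤ (λ j → Σℤ (λ l → h (suc j) (suc l))))
    ≡⟨ cong (λ x → Σℤ (h zero) + (Σℤ (λ j → h (suc j) zero) + x))
         (∑∑-exchange (λ j l → h (suc j) (suc l))) ⟩
  Σℤ (h zero) + (Σℤ (λ j → h (suc j) zero) + r)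
    ≡⟨ lem (Σℤ (h zero)) (Σℤ (λ j → h (suc j) zero)) r ⟩
  Σℤ (λ j → h (suc j) zero) + (Σℤ (h zero) + r)
    ≡⟨ cong (Σℤ (λ j → h (suc j) zero) +_) 
         (ℤΣ.∑-distrib-+ (h zero) (λ j → Σℤ (λ l → h (suc (punchIn j l)) (suc (pinch l j))))) ⟨
  Σℤ (λ j → h (suc j) zero) + Σℤ (λ j → h zero j + Σℤ (λ l → h (suc (punchIn j l)) (suc (pinch l j)))) ∎
  where
  open ≡-Reasoning
  r = Σℤ (λ j → Σℤ (λ l → h (suc (punchIn j l)) (suc (pinch l j))))
  lem : ∀ x y z → x + (y + z) ≡ y + (x + z)
  lem = solve-∀

double-self : ∀ x → x ≡ - x → x ≡ 0ℤ
double-self (ℤ.+ zero) eq = refl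
double-self (ℤ.+ suc n) ()
double-self ℤ.-[1+ n ] ()

module _ {k} (N : Mat ℤ k (suc (suc k))) where

  -- By `det-cofactor` this is the determinant with rows `u`, `v` and then those of `N`; expanding
  -- it twice makes antisymmetry a reindexing of a double sum.
  alternating : (u v : Fin (suc (suc k)) → ℤ) → ℤ
  alternating u v = Σℤ (λ j → cofactor (v ∷ N) j * u j)

  private
    delete : (j : Fin (suc (suc k))) → Mat ℤ k (suc k)
    delete j a b = N a (punchIn j b)

    summand : (u v : Fin (suc (suc k)) → ℤ) → Fin (suc (suc k)) → Fin (suc k) → ℤ
    summand u v j l = sgn j * sgn l * minor (delete j) l * u j * v (punchIn j l)

  alternating-expand : ∀ u v → alternating u v ≡ Σℤ (λ j → Σℤ (λ l → summand u v j l))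
  alternating-expand u v = ℤΣ.∑-cong λ j → begin
    sgn j * det (λ a b → (v ∷ N) a (punchIn j b)) * u j
      ≡⟨ cong (λ d → sgn j * d * u j) (det-cofactor (λ a b → (v ∷ N) a (punchIn j b))) ⟩
    sgn j * Σℤ (λ l → cofactor (delete j) l * v (punchIn j l)) * u j
      ≡⟨ lem₁ (sgn j) (Σℤ (λ l → cofactor (delete j) l * v (punchIn j l))) (u j) ⟩
    sgn j * u j * Σℤ (λ l → cofactor (delete j) l * v (punchIn j l))
      ≡⟨ ℤΣ.*-distribˡ-∑ (sgn j * u j) (λ l → cofactor (delete j) l * v (punchIn j l)) ⟩
    Σℤ (λ l → sgn j * u j * (cofactor (delete j) l * v (punchIn j l)))
      ≡⟨ ℤΣ.∑-cong (λ l → lem₂ (sgn j) (u j) (sgn l) (minor (delete j) l) (v (punchIn j l))) ⟩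
    Σℤ (λ l → summand u v j l) ∎
    where
    open ≡-Reasoning
    lem₁ : ∀ x y z → x * y * z ≡ x * z * y
    lem₁ = solve-∀
    lem₂ : ∀ s u t m v → s * u * (t * m * v) ≡ s * t * m * u * v
    lem₂ = solve-∀

  summand-exchange : ∀ u v j l → summand u v (punchIn j l) (pinch l j) ≡ -1ℤ * summand v u j l
  summand-exchange u v j l = begin
    sgn (punchIn j l) * sgn (pinch l j) * minor (delete (punchIn j l)) (pinch l j)
      * u (punchIn j l) * v (punchIn (punchIn j l) (pinch l j))
      ≡⟨ cong₂ (λ s m → s * m * u (punchIn j l) * v (punchIn (punchIn j l) (pinch l j)))
           (sgn-punchIn-pinch j l)
           (det-cong (λ a b → cong (N a) (punchIn-punchIn-pinch j l b))) ⟩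
    - (sgn j * sgn l) * minor (delete j) l * u (punchIn j l) * v (punchIn (punchIn j l) (pinch l j))
      ≡⟨ cong (λ i → - (sgn j * sgn l) * minor (delete j) l * u (punchIn j l) * v i) (punchIn-pinch j l) ⟩
    - (sgn j * sgn l) * minor (delete j) l * u (punchIn j l) * v j
      ≡⟨ lem (sgn j * sgn l) (minor (delete j) l) (u (punchIn j l)) (v j) ⟩
    -1ℤ * summand v u j l ∎
    where
    open ≡-Reasoning
    lem : ∀ s m x y → - s * m * x * y ≡ -1ℤ * (s * m * y * x)
    lem = solve-∀

  alternating-swap : ∀ u v → alternating u v ≡ - alternating v u
  alternating-swap u v = begin
    alternating u v
      ≡⟨ alternating-expand u v ⟩
    Σℤ (λ j → Σℤ (λ l → summand u v j l))
      ≡⟨ ∑∑-exchange (summand u v) ⟩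
    Σℤ (λ j → Σℤ (λ l → summand u v (punchIn j l) (pinch l j)))
      ≡⟨ ℤΣ.∑-cong (λ j → ℤΣ.∑-cong (summand-exchange u v j)) ⟩
    Σℤ (λ j → Σℤ (λ l → -1ℤ * summand v u j l))
      ≡⟨ ℤΣ.∑-cong (λ j → ℤΣ.*-distribˡ-∑ -1ℤ (summand v u j)) ⟨
    Σℤ (λ j → -1ℤ * Σℤ (λ l → summand v u j l))
      ≡⟨ ℤΣ.*-distribˡ-∑ -1ℤ (λ j → Σℤ (λ l → summand v u j l)) ⟨
    -1ℤ * Σℤ (λ j → Σℤ (λ l → summand v u j l))
      ≡⟨ cong (-1ℤ *_) (alternating-expand v u) ⟨
    -1ℤ * alternating v u
      ≡⟨ ℤ.-1*i≡-i (alternating v u) ⟩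
    - alternating v u ∎
    where open ≡-Reasoning

head-tail : ∀ {k n} (N : Mat ℤ (suc k) n) → ∀ a b → (N zero ∷ (λ i → N (suc i))) a b ≡ N a b
head-tail N zero    b = refl
head-tail N (suc a) b = refl

-- A determinant with a repeated row vanishes. If the top row is repeated, exchanging the two copies
-- negates the sum. Otherwise the exchange brings `N zero` to the front, and each minor below it
-- vanishes by the same identity one size smaller.
cofactor-kernel : ∀ {k} (N : Mat ℤ k (suc k)) i → Σℤ (λ j → cofactor N j * N i j) ≡ 0ℤ
cofactor-kernel {suc k} N zero = double-self _ (begin
  Σℤ (λ j → cofactor N j * N zero j)
    ≡⟨ eq ⟨
  alternating (λ a → N (suc a)) (N zero) (N zero)
    ≡⟨ alternating-swap (λ a → N (suc a)) (N zero) (N zero) ⟩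
  - alternating (λ a → N (suc a)) (N zero) (N zero)
    ≡⟨ cong -_ eq ⟩
  - Σℤ (λ j → cofactor N j * N zero j) ∎)
  where
  open ≡-Reasoning
  eq : alternating (λ a → N (suc a)) (N zero) (N zero) ≡ Σℤ (λ j → cofactor N j * N zero j)
  eq = ℤΣ.∑-cong λ j → cong (_* N zero j) (cofactor-cong (head-tail N) j)
cofactor-kernel {suc k} N (suc i) = begin
  Σℤ (λ j → cofactor N j * N (suc i) j)
    ≡⟨ ℤΣ.∑-cong (λ j → cong (_* N (suc i) j) (cofactor-cong (head-tail N) j)) ⟨
  alternating (λ a → N (suc a)) (N (suc i)) (N zero)
    ≡⟨ alternating-swap (λ a → N (suc a)) (N (suc i)) (N zero) ⟩
  - alternating (λ a → N (suc a)) (N zero) (N (suc i))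
    ≡⟨ cong -_ (ℤΣ.∑-zero vanish) ⟩
  0ℤ ∎
  where
  open ≡-Reasoning
  M : Mat ℤ (suc k) (suc (suc k))
  M = N (suc i) ∷ (λ a → N (suc a))
  vanish : ∀ j → cofactor M j * N zero j ≡ 0ℤ
  vanish j = begin
    sgn j * minor M j * N zero j
      ≡⟨ cong (λ d → sgn j * d * N zero j) (trans (det-cofactor (λ a b → M a (punchIn j b)))
           (cofactor-kernel (λ a b → N (suc a) (punchIn j b)) i)) ⟩
    sgn j * 0ℤ * N zero j
      ≡⟨ lem (sgn j) (N zero j) ⟩
    0ℤ ∎
    where
    lem : ∀ x y → x * 0ℤ * y ≡ 0ℤ
    lem = solve-∀

-- Kernels of integer matrices

Ternary : ℤ → Set
Ternary x = x ≡ 0ℤ ⊎ x ≡ 1ℤ ⊎ x ≡ -1ℤ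

Ternary-* : ∀ {x y} → Ternary x → Ternary y → Ternary (x * y)
Ternary-* (inj₁ refl)        ty                 = inj₁ refl
Ternary-* (inj₂ (inj₁ refl)) ty                 = subst Ternary (sym (ℤ.*-identityˡ _)) ty
Ternary-* (inj₂ (inj₂ refl)) (inj₁ refl)        = inj₁ refl
Ternary-* (inj₂ (inj₂ refl)) (inj₂ (inj₁ refl)) = inj₂ (inj₂ refl)
Ternary-* (inj₂ (inj₂ refl)) (inj₂ (inj₂ refl)) = inj₂ (inj₁ refl)

Ternary-neg : ∀ {x} → Ternary x → Ternary (- x)
Ternary-neg (inj₁ refl)        = inj₁ refl
Ternary-neg (inj₂ (inj₁ refl)) = inj₂ (inj₂ refl)
Ternary-neg (inj₂ (inj₂ refl)) = inj₂ (inj₁ refl)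

Ternary-square : ∀ {x} → Ternary x → x ≢ 0ℤ → x * x ≡ 1ℤ
Ternary-square (inj₁ eq)          x≢0 = contradiction eq x≢0
Ternary-square (inj₂ (inj₁ refl)) x≢0 = refl
Ternary-square (inj₂ (inj₂ refl)) x≢0 = refl

Ternary-sgn : ∀ {n} (i : Fin n) → Ternary (sgn i)
Ternary-sgn zero    = inj₂ (inj₁ refl)
Ternary-sgn (suc i) = Ternary-neg (Ternary-sgn i)

idℤ-diag : ∀ {n} (i : Fin n) → idℤ i i ≡ 1ℤ
idℤ-diag i with i ≟ i
... | yes _  = refl
... | no i≢i = contradiction refl i≢i

idℤ-off : ∀ {n} {i j : Fin n} → i ≢ j → idℤ i j ≡ 0ℤ
idℤ-off {i = i} {j} i≢j with i ≟ j
... | yes i≡j = contradiction i≡j i≢j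
... | no _    = refl

Σ-idℤˡ : ∀ {n} (i : Fin n) (f : Fin n → ℤ) → Σℤ (λ l → idℤ i l * f l) ≡ f i
Σ-idℤˡ i f = trans
  (ℤΣ.∑-single i (λ j j≢i → cong (_* f j) (idℤ-off (λ i≡j → j≢i (sym i≡j)))))
  (trans (cong (_* f i) (idℤ-diag i)) (ℤ.*-identityˡ (f i)))

Σ-idℤʳ : ∀ {n} (i : Fin n) (f : Fin n → ℤ) → Σℤ (λ l → f l * idℤ l i) ≡ f i
Σ-idℤʳ i f = trans
  (ℤΣ.∑-single i (λ j j≢i → trans (cong (f j *_) (idℤ-off j≢i)) (ℤ.*-zeroʳ (f j))))
  (trans (cong (f i *_) (idℤ-diag i)) (ℤ.*-identityʳ (f i)))

∃-nonzero : ∀ {n} (f : Fin n → ℤ) → ¬ (∀ i → f i ≡ 0ℤ) → ∃ λ i → f i ≢ 0ℤ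
∃-nonzero f = ¬∀⟶∃¬ _ (λ i → f i ≡ 0ℤ) (λ i → f i ℤ.≟ 0ℤ)

*-cancel-≢0 : ∀ {x y} → x ≢ 0ℤ → y * x ≡ 0ℤ → y ≡ 0ℤ
*-cancel-≢0 {x} {y} x≢0 eq with ℤ.i*j≡0⇒i≡0∨j≡0 y eq
... | inj₁ y≡0 = y≡0
... | inj₂ x≡0 = contradiction x≡0 x≢0

_∈ker_ : ∀ {m n} → (Fin n → ℤ) → Mat ℤ m n → Set
z ∈ker M = ∀ a → Σℤ (λ j → z j * M a j) ≡ 0ℤ

Σ-linear : ∀ {n} x y (u w f : Fin n → ℤ) →
  Σℤ (λ j → (x * u j + y * w j) * f j) ≡ x * Σℤ (λ j → u j * f j) + y * Σℤ (λ j → w j * f j)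
Σ-linear x y u w f = begin
  Σℤ (λ j → (x * u j + y * w j) * f j)
    ≡⟨ ℤΣ.∑-cong (λ j → lem x y (u j) (w j) (f j)) ⟩
  Σℤ (λ j → x * (u j * f j) + y * (w j * f j))
    ≡⟨ ℤΣ.∑-distrib-+ (λ j → x * (u j * f j)) (λ j → y * (w j * f j)) ⟩
  Σℤ (λ j → x * (u j * f j)) + Σℤ (λ j → y * (w j * f j))
    ≡⟨ cong₂ _+_ (ℤΣ.*-distribˡ-∑ x (λ j → u j * f j)) (ℤΣ.*-distribˡ-∑ y (λ j → w j * f j)) ⟨
  x * Σℤ (λ j → u j * f j) + y * Σℤ (λ j → w j * f j) ∎
  where
  open ≡-Reasoning
  lem : ∀ x y u w f → (x * u + y * w) * f ≡ x * (u * f) + y * (w * f)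
  lem = solve-∀

module _ {k} (N : Mat ℤ k (suc k)) {z c : Fin (suc k) → ℤ} (j : Fin (suc k))
  (Nz≡0 : z ∈ker N) (Nc≡0 : c ∈ker N) where
  open ≡-Reasoning

  -- The combination `d` of the two kernel vectors is made to vanish at `j`; the rest of it is a
  -- kernel vector of the square matrix without column `j`, hence zero.
  kernel-proportional : (∀ w → w ∈ker (λ a b → N a (punchIn j b)) → ∀ l → w l ≡ 0ℤ) →
    ∀ i → c i * z j ≡ z i * c j
  kernel-proportional trivial i =
    ℤ.i-j≡0⇒i≡j (c i * z j) (z i * c j) (trans (lem (c i) (z j) (z i) (c j)) (d≡0 i))
    where
    lem : ∀ c z z′ c′ → c * z - z′ * c′ ≡ z * c + - c′ * z′
    lem = solve-∀
    d : Fin (suc k) → ℤ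
    d i = z j * c i + - c j * z i
    Nd≡0 : d ∈ker N
    Nd≡0 a = begin
      Σℤ (λ i → d i * N a i)
        ≡⟨ Σ-linear (z j) (- c j) c z (N a) ⟩
      z j * Σℤ (λ i → c i * N a i) + - c j * Σℤ (λ i → z i * N a i)
        ≡⟨ cong₂ (λ x y → z j * x + - c j * y) (Nc≡0 a) (Nz≡0 a) ⟩
      z j * 0ℤ + - c j * 0ℤ
        ≡⟨ zeros (z j) (- c j) ⟩
      0ℤ ∎
      where
      zeros : ∀ x y → x * 0ℤ + y * 0ℤ ≡ 0ℤ
      zeros = solve-∀
    dⱼ≡0 : d j ≡ 0ℤ
    dⱼ≡0 = cancel (z j) (c j)
      where
      cancel : ∀ x y → x * y + - y * x ≡ 0ℤ
      cancel = solve-∀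
    d-punchIn : ∀ l → d (punchIn j l) ≡ 0ℤ
    d-punchIn = trivial (λ l → d (punchIn j l)) λ a → begin
      Σℤ (λ l → d (punchIn j l) * N a (punchIn j l))
        ≡⟨ ℤ.+-identityˡ (Σℤ (λ l → d (punchIn j l) * N a (punchIn j l))) ⟨
      0ℤ + Σℤ (λ l → d (punchIn j l) * N a (punchIn j l))
        ≡⟨ cong (λ x → x * N a j + Σℤ (λ l → d (punchIn j l) * N a (punchIn j l))) dⱼ≡0 ⟨
      d j * N a j + Σℤ (λ l → d (punchIn j l) * N a (punchIn j l))
        ≡⟨ ℤΣ.∑-remove j (λ l → d l * N a l) ⟨
      Σℤ (λ l → d l * N a l)
        ≡⟨ Nd≡0 a ⟩
      0ℤ ∎
    d≡0 : ∀ i → d i ≡ 0ℤ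
    d≡0 i with j ≟ i
    ... | yes refl = dⱼ≡0
    ... | no j≢i   = subst (λ i → d i ≡ 0ℤ) (punchIn-punchOut j≢i) (d-punchIn (punchOut j≢i))

-- In `c j * D`, trading each `z i * c j` for `c i * z j` leaves `z j` times the pairing of `c` with
-- `u`, which is zero. So `c j` vanishes, and proportionality spreads this to every `c i`.
proportional-vanish : ∀ {k} {z c u : Fin k → ℤ} j {D} → D ≢ 0ℤ → z j ≢ 0ℤ →
  D ≡ Σℤ (λ i → z i * u i) → Σℤ (λ i → c i * u i) ≡ 0ℤ →
  (∀ i → c i * z j ≡ z i * c j) → ∀ i → c i ≡ 0ℤ
proportional-vanish {z = z} {c} {u} j {D} D≢0 zⱼ≢0 eqD uc≡0 proportional i =
  *-cancel-≢0 zⱼ≢0 (trans (proportional i) (trans (cong (z i *_) cⱼ≡0) (ℤ.*-zeroʳ (z i))))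
  where
  open ≡-Reasoning
  lem₁ : ∀ c z m → c * (z * m) ≡ z * c * m
  lem₁ = solve-∀
  lem₂ : ∀ c z m → c * z * m ≡ z * (c * m)
  lem₂ = solve-∀
  cⱼ≡0 : c j ≡ 0ℤ
  cⱼ≡0 = *-cancel-≢0 D≢0 (begin
    c j * D
      ≡⟨ cong (c j *_) eqD ⟩
    c j * Σℤ (λ i → z i * u i)
      ≡⟨ ℤΣ.*-distribˡ-∑ (c j) (λ i → z i * u i) ⟩
    Σℤ (λ i → c j * (z i * u i))
      ≡⟨ ℤΣ.∑-cong (λ i → trans (lem₁ (c j) (z i) (u i))
           (trans (cong (_* u i) (sym (proportional i))) (lem₂ (c i) (z j) (u i)))) ⟩
    Σℤ (λ i → z j * (c i * u i))
      ≡⟨ ℤΣ.*-distribˡ-∑ (z j) (λ i → c i * u i) ⟨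
    z j * Σℤ (λ i → c i * u i)
      ≡⟨ cong (z j *_) uc≡0 ⟩
    z j * 0ℤ
      ≡⟨ ℤ.*-zeroʳ (z j) ⟩
    0ℤ ∎)

-- The kernel of the lower rows is spanned by their cofactors, so a kernel vector c of M
-- is proportional to the cofactors; pairing with the first row turns this into c * det M = 0.
det-kernel : ∀ {k} (M : Mat ℤ k k) → det M ≢ 0ℤ → ∀ c → c ∈ker M → ∀ j → c j ≡ 0ℤ
det-kernel {suc k} M det≢0 c Mc≡0 with ∃-nonzero (cofactor (λ a → M (suc a))) all-zero
  where
  all-zero : ¬ (∀ j → cofactor (λ a → M (suc a)) j ≡ 0ℤ)
  all-zero z≡0 = det≢0 (trans (det-cofactor M)
    (ℤΣ.∑-zero {f = λ j → cofactor (λ a → M (suc a)) j * M zero j} (λ j → cong (_* M zero j) (z≡0 j))))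
... | j , zⱼ≢0 = proportional-vanish {z = cofactor N} {c} {M zero} j det≢0 zⱼ≢0 (det-cofactor M) (Mc≡0 zero)
        (kernel-proportional N {cofactor N} {c} j (cofactor-kernel N) (λ a → Mc≡0 (suc a))
          (det-kernel (λ a b → N a (punchIn j b)) minor≢0))
  where
  N : Mat ℤ k (suc k)
  N a = M (suc a)
  minor≢0 : minor N j ≢ 0ℤ
  minor≢0 eq = zⱼ≢0 (trans (cong (sgn j *_) eq) (ℤ.*-zeroʳ (sgn j)))

-- Linear independence and bases of columns

submatrix : ∀ {g n k l} → Mat ℤ g n → (Fin k → Fin g) → (Fin l → Fin n) → Mat ℤ k l
submatrix A r c a b = A (r a) (c b)

columns : ∀ {g n l} → Mat ℤ g n → (Fin l → Fin n) → Mat ℤ g l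
columns A c a b = A a (c b)

-- Families with integer coefficients take the place of subsets with rational ones, so that a member
-- can be exchanged at its position. Clearing denominators reconnects the two notions.
LinIndep : ∀ {g n k} → Mat ℤ g n → (Fin k → Fin n) → Set
LinIndep A c = ∀ z → z ∈ker columns A c → ∀ j → z j ≡ 0ℤ

-- Membership in the lattice generated by the family, which is stronger than rational dependence.
InSpan : ∀ {g n k} → Mat ℤ g n → (Fin k → Fin n) → Fin n → Set
InSpan {k = k} A c e = Σ (Fin k → ℤ) λ x → ∀ a → A a e ≡ Σℤ (λ j → x j * A a (c j))

minor≢0⇒LinIndep : ∀ {g n k} (A : Mat ℤ g n) (r : Fin k → Fin g) (c : Fin k → Fin n) →
  det (submatrix A r c) ≢ 0ℤ → LinIndep A c
minor≢0⇒LinIndep A r c det≢0 z eq = det-kernel (submatrix A r c) det≢0 z (λ a → eq (r a))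

LinIndep-tail : ∀ {g n k} (A : Mat ℤ g n) (c : Fin (suc k) → Fin n) → LinIndep A c → LinIndep A (c ∘ suc)
LinIndep-tail A c ind z eq j = ind (0ℤ ∷ z)
  (λ a → trans (ℤ.+-identityˡ (Σℤ (λ j → z j * A a (c (suc j))))) (eq a)) (suc j)

LinIndep-injective : ∀ {g n k} (A : Mat ℤ g n) (c : Fin k → Fin n) → LinIndep A c → Injective _≡_ _≡_ c
LinIndep-injective A c ind {i} {j} cᵢ≡cⱼ with i ≟ j
... | yes i≡j = i≡j
... | no i≢j  = contradiction (trans (sym z≡1) (ind z eq i)) λ ()
  where
  open ≡-Reasoning
  z : Fin _ → ℤ
  -- The factors `1ℤ` and `-1ℤ` stay explicit so that `Σ-linear` applies as it stands; the same
  -- shape recurs below.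
  z l = 1ℤ * idℤ i l + -1ℤ * idℤ j l
  z≡1 : z i ≡ 1ℤ
  z≡1 = cong₂ (λ x y → 1ℤ * x + -1ℤ * y) (idℤ-diag i) (idℤ-off (λ j≡i → i≢j (sym j≡i)))
  eq : z ∈ker columns A c
  eq a = begin
    Σℤ (λ l → z l * A a (c l))
      ≡⟨ Σ-linear 1ℤ -1ℤ (idℤ i) (idℤ j) (λ l → A a (c l)) ⟩
    1ℤ * Σℤ (λ l → idℤ i l * A a (c l)) + -1ℤ * Σℤ (λ l → idℤ j l * A a (c l))
      ≡⟨ cong₂ (λ x y → 1ℤ * x + -1ℤ * y) (Σ-idℤˡ i (λ l → A a (c l))) (Σ-idℤˡ j (λ l → A a (c l))) ⟩
    1ℤ * A a (c i) + -1ℤ * A a (c j)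
      ≡⟨ cong (λ e → 1ℤ * A a (c i) + -1ℤ * A a e) (sym cᵢ≡cⱼ) ⟩
    1ℤ * A a (c i) + -1ℤ * A a (c i)
      ≡⟨ cancel (A a (c i)) ⟩
    0ℤ ∎
    where
    cancel : ∀ x → 1ℤ * x + -1ℤ * x ≡ 0ℤ
    cancel = solve-∀

record NonsingularRows {g n k} (A : Mat ℤ g n) (c : Fin k → Fin n) : Set where
  field
    rows      : Fin k → Fin g
    injective : Injective _≡_ _≡_ rows
    det≢0     : det (submatrix A rows c) ≢ 0ℤ
open NonsingularRows

∷-injective : ∀ {A : Set} {k} {a : A} {r : Fin k → A} → Injective _≡_ _≡_ r → (∀ i → a ≢ r i) →
  Injective _≡_ _≡_ (a ∷ r)
∷-injective inj a∉r {zero}  {zero}  eq = refl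
∷-injective inj a∉r {zero}  {suc j} eq = contradiction eq (a∉r j)
∷-injective inj a∉r {suc i} {zero}  eq = contradiction (sym eq) (a∉r i)
∷-injective inj a∉r {suc i} {suc j} eq = cong suc (inj eq)

module _ {g n k} (A : Mat ℤ g n) (c : Fin (suc k) → Fin n) (R : NonsingularRows A (c ∘ suc)) where
  private
    z : Fin (suc k) → ℤ
    z = cofactor (submatrix A (rows R) c)

  cofactor-zero : z zero ≢ 0ℤ
  cofactor-zero eq = det≢0 R (trans (sym (ℤ.*-identityˡ _)) eq)

  -- Pairing row `a` with the cofactor vector gives the minor enlarged by `a`. The rows already
  -- chosen pair to zero, so `a` is a new one.
  extend-rows : ∀ a → Σℤ (λ j → z j * A a (c j)) ≢ 0ℤ → NonsingularRows A c
  extend-rows a nz = record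
    { rows      = a ∷ rows R
    ; injective = ∷-injective (injective R) λ i a≡rᵢ → nz (trans
        (cong (λ a → Σℤ (λ j → z j * A a (c j))) a≡rᵢ)
        (cofactor-kernel (submatrix A (rows R) c) i))
    ; det≢0     = λ eq → nz (trans (sym (det-cofactor (submatrix A (a ∷ rows R) c))) eq)
    }

-- The cofactor vector has a nonzero entry at `zero`, so independence keeps it out of the kernel; a
-- row that detects this enlarges the minor of the remaining columns.
nonsingular-rows : ∀ {g n k} (A : Mat ℤ g n) (c : Fin k → Fin n) → LinIndep A c → NonsingularRows A c
nonsingular-rows {k = zero}  A c ind = record { rows = λ () ; injective = λ { {()} } ; det≢0 = λ () }
nonsingular-rows {k = suc k} A c ind = extend-rows A c R (proj₁ row) (proj₂ row)
  where
  R = nonsingular-rows A (c ∘ suc) (LinIndep-tail A c ind)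
  row = ∃-nonzero (λ a → Σℤ (λ j → cofactor (submatrix A (rows R) c) j * A a (c j)))
    (λ eq → cofactor-zero A c R (ind (cofactor (submatrix A (rows R) c)) eq zero))

module _ {g n} (A : Mat ℤ g n) (TU : TotallyUnimodular A) where

  -- Here `c` may repeat columns, unlike in `TotallyUnimodular`: a nonzero minor has independent,
  -- therefore distinct, columns.
  minor-ternary : ∀ {k} (r : Fin k → Fin g) → Injective _≡_ _≡_ r → (c : Fin k → Fin n) →
    Ternary (det (submatrix A r c))
  minor-ternary r r-inj c with det (submatrix A r c) ℤ.≟ 0ℤ
  ... | yes eq = inj₁ eq
  ... | no neq = TU _ r c r-inj (LinIndep-injective A c (minor≢0⇒LinIndep A r c neq))

  cofactor-ternary : ∀ {k} (r : Fin k → Fin g) → Injective _≡_ _≡_ r → (c : Fin (suc k) → Fin n) →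
    ∀ j → Ternary (cofactor (submatrix A r c) j)
  cofactor-ternary r r-inj c j = Ternary-* (Ternary-sgn j) (minor-ternary r r-inj (c ∘ punchIn j))

  -- Up to scale the cofactor vector is the only possible dependency. If it annihilates every row,
  -- its entry at `e` is 1 or -1 and the relation can be solved for `e` over `ℤ`; otherwise some row
  -- yields a larger nonzero minor.
  span-or-extend : ∀ {k} (c : Fin k → Fin n) → LinIndep A c → ∀ e → InSpan A c e ⊎ LinIndep A (e ∷ c)
  span-or-extend {k} c ind e with nonsingular-rows A c ind
  ... | R with all? (λ a → Σℤ (λ j → cofactor (submatrix A (rows R) (e ∷ c)) j * A a ((e ∷ c) j)) ℤ.≟ 0ℤ)
  ...   | yes eq = inj₁ ((λ j → - z zero * z (suc j)) , λ a → sym (begin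
    Σℤ (λ j → - z zero * z (suc j) * A a (c j))
      ≡⟨ ℤΣ.∑-cong (λ j → ℤ.*-assoc (- z zero) (z (suc j)) (A a (c j))) ⟩
    Σℤ (λ j → - z zero * (z (suc j) * A a (c j)))
      ≡⟨ ℤΣ.*-distribˡ-∑ (- z zero) (λ j → z (suc j) * A a (c j)) ⟨
    - z zero * Σℤ (λ j → z (suc j) * A a (c j))
      ≡⟨ lem (z zero) (A a e) (Σℤ (λ j → z (suc j) * A a (c j))) ⟩
    z zero * z zero * A a e - z zero * (z zero * A a e + Σℤ (λ j → z (suc j) * A a (c j)))
      ≡⟨ cong₂ (λ x y → x * A a e - z zero * y) z₀²≡1 (eq a) ⟩
    1ℤ * A a e - z zero * 0ℤ
      ≡⟨ lem′ (z zero) (A a e) ⟩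
    A a e ∎))
    where
    open ≡-Reasoning
    z : Fin (suc k) → ℤ
    z = cofactor (submatrix A (rows R) (e ∷ c))
    z₀²≡1 : z zero * z zero ≡ 1ℤ
    z₀²≡1 = Ternary-square (cofactor-ternary (rows R) (injective R) (e ∷ c) zero) (cofactor-zero A (e ∷ c) R)
    lem : ∀ z v s → - z * s ≡ z * z * v - z * (z * v + s)
    lem = solve-∀
    lem′ : ∀ z v → 1ℤ * v - z * 0ℤ ≡ v
    lem′ = solve-∀
  ...   | no neq = inj₂ (minor≢0⇒LinIndep A (rows R′) (e ∷ c) (det≢0 R′))
    where
    row = ¬∀⟶∃¬ g (λ a → Σℤ (λ j → cofactor (submatrix A (rows R) (e ∷ c)) j * A a ((e ∷ c) j)) ≡ 0ℤ)
      (λ a → Σℤ (λ j → cofactor (submatrix A (rows R) (e ∷ c)) j * A a ((e ∷ c) j)) ℤ.≟ 0ℤ) neq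
    R′ = extend-rows A (e ∷ c) R (proj₁ row) (proj₂ row)

  -- Cramer's rule: `w` compares `x` with the solution read off the cofactors and lies in the kernel
  -- of a nonsingular minor. Hence each `x j` is, up to sign, a product of two minors.
  span-ternary : ∀ {k} (c : Fin k → Fin n) → LinIndep A c → ∀ e (x : Fin k → ℤ) →
    (∀ a → A a e ≡ Σℤ (λ j → x j * A a (c j))) → ∀ j → Ternary (x j)
  span-ternary {k} c ind e x eq j = subst Ternary xⱼ (Ternary-neg (Ternary-* (tern zero) (tern (suc j))))
    where
    open ≡-Reasoning
    R = nonsingular-rows A c ind
    N = submatrix A (rows R) (e ∷ c)
    z = cofactor N
    tern : ∀ j → Ternary (z j)
    tern = cofactor-ternary (rows R) (injective R) (e ∷ c)
    z₀²≡1 : z zero * z zero ≡ 1ℤ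
    z₀²≡1 = Ternary-square (tern zero) (cofactor-zero A (e ∷ c) R)
    w : Fin k → ℤ
    w j = 1ℤ * z (suc j) + z zero * x j
    w∈ker : w ∈ker submatrix A (rows R) c
    w∈ker i = begin
      Σℤ (λ j → w j * N i (suc j))
        ≡⟨ Σ-linear 1ℤ (z zero) (λ j → z (suc j)) x (λ j → N i (suc j)) ⟩
      1ℤ * Σℤ (λ j → z (suc j) * N i (suc j)) + z zero * Σℤ (λ j → x j * N i (suc j))
        ≡⟨ cong (λ v → 1ℤ * Σℤ (λ j → z (suc j) * N i (suc j)) + z zero * v) (eq (rows R i)) ⟨
      1ℤ * Σℤ (λ j → z (suc j) * N i (suc j)) + z zero * N i zero
        ≡⟨ swap (Σℤ (λ j → z (suc j) * N i (suc j))) (z zero * N i zero) ⟩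
      z zero * N i zero + Σℤ (λ j → z (suc j) * N i (suc j))
        ≡⟨ cofactor-kernel N i ⟩
      0ℤ ∎
      where
      swap : ∀ x y → 1ℤ * x + y ≡ y + x
      swap = solve-∀
    wⱼ≡0 : w j ≡ 0ℤ
    wⱼ≡0 = det-kernel (submatrix A (rows R) c) (det≢0 R) w w∈ker j
    xⱼ : - (z zero * z (suc j)) ≡ x j
    xⱼ = begin
      - (z zero * z (suc j))
        ≡⟨ lem (z zero) (z (suc j)) (x j) ⟩
      z zero * z zero * x j - z zero * w j
        ≡⟨ cong₂ (λ s t → s * x j - z zero * t) z₀²≡1 wⱼ≡0 ⟩
      1ℤ * x j - z zero * 0ℤ
        ≡⟨ lem′ (z zero) (x j) ⟩
      x j ∎
      where
      lem : ∀ z y x → - (z * y) ≡ z * z * x - z * (1ℤ * y + z * x)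
      lem = solve-∀
      lem′ : ∀ z x → 1ℤ * x - z * 0ℤ ≡ x
      lem′ = solve-∀

  record Basis : Set where
    field
      rank        : ℕ
      basis       : Fin rank → Fin n
      independent : LinIndep A basis
      spanning    : ∀ e → InSpan A basis e

  private
    span-weaken : ∀ {k} (c : Fin k → Fin n) e {e′} → InSpan A c e′ → InSpan A (e ∷ c) e′
    span-weaken c e (x , eq) = 0ℤ ∷ x , λ a →
      trans (eq a) (sym (ℤ.+-identityˡ (Σℤ (λ j → x j * A a (c j)))))

    span-new : ∀ {k} (c : Fin k → Fin n) e → InSpan A (e ∷ c) e
    span-new c e = idℤ zero , λ a → sym (Σ-idℤˡ zero (λ j → A a ((e ∷ c) j)))

    greedy : (es : List (Fin n)) → Σ ℕ λ k → Σ (Fin k → Fin n) λ c → LinIndep A c × (∀ {e} → e ∈ es → InSpan A c e)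
    greedy [] = 0 , (λ ()) , (λ _ _ ()) , λ ()
    greedy (e List.∷ es) with greedy es
    ... | k , c , ind , span with span-or-extend c ind e
    ...   | inj₁ e∈span = k , c , ind , λ { (here refl) → e∈span ; (there e∈es) → span e∈es }
    ...   | inj₂ ind′   = suc k , (e ∷ c) , ind′ ,
      λ { (here refl) → span-new c e ; (there e∈es) → span-weaken c e (span e∈es) }

  exists-basis : Basis
  exists-basis with greedy (allFin n)
  ... | k , c , ind , span = record { rank = k ; basis = c ; independent = ind ; spanning = λ e → span (∈-allFin e) }

-- Pivots

IsSign : ℤ → Set
IsSign x = x ≡ 1ℤ ⊎ x ≡ -1ℤ

IsSign-square : ∀ {x} → IsSign x → x * x ≡ 1ℤ
IsSign-square (inj₁ refl) = refl
IsSign-square (inj₂ refl) = refl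

IsSign-* : ∀ {x y} → IsSign x → IsSign y → IsSign (x * y)
IsSign-* (inj₁ refl) (inj₁ refl) = inj₁ refl
IsSign-* (inj₁ refl) (inj₂ refl) = inj₂ refl
IsSign-* (inj₂ refl) (inj₁ refl) = inj₂ refl
IsSign-* (inj₂ refl) (inj₂ refl) = inj₁ refl

Ternary-sign : ∀ {x} → Ternary x → x ≢ 0ℤ → IsSign x
Ternary-sign (inj₁ x≡0) x≢0 = contradiction x≡0 x≢0
Ternary-sign (inj₂ s)   x≢0 = s

-- Opposite signs differ by 2 or -2. This is how the bound on the entries of a pivoted matrix
-- determines an entry of the original one.
IsSign-difference : ∀ {x y} → IsSign x → IsSign y → Ternary (x - y) → x ≡ y
IsSign-difference (inj₁ refl) (inj₁ refl) _ = refl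
IsSign-difference (inj₂ refl) (inj₂ refl) _ = refl
IsSign-difference (inj₁ refl) (inj₂ refl) (inj₁ ())
IsSign-difference (inj₁ refl) (inj₂ refl) (inj₂ (inj₁ ()))
IsSign-difference (inj₁ refl) (inj₂ refl) (inj₂ (inj₂ ()))
IsSign-difference (inj₂ refl) (inj₁ refl) (inj₁ ())
IsSign-difference (inj₂ refl) (inj₁ refl) (inj₂ (inj₁ ()))
IsSign-difference (inj₂ refl) (inj₁ refl) (inj₂ (inj₂ ()))

replace : ∀ {A : Set} {k} → (Fin k → A) → Fin k → A → Fin k → A
replace c p f = updateAt c p (const f)

replace-at : ∀ {A : Set} {k} (c : Fin k → A) p f → replace c p f p ≡ f
replace-at c p f = updateAt-updates p c

replace-punchIn : ∀ {A : Set} {k} (c : Fin (suc k) → A) p f j →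
  replace c p f (punchIn p j) ≡ c (punchIn p j)
replace-punchIn c p f j = updateAt-minimal (punchIn p j) p c (punchInᵢ≢i p j)

Σ-replace : ∀ {k n} (c : Fin k → Fin n) p f (z : Fin k → ℤ) (u : Fin n → ℤ) →
  Σℤ (λ j → z j * u (replace c p f j)) ≡ Σℤ (λ j → z j * u (c j)) + z p * (u f - u (c p))
Σ-replace {suc k} c p f z u = begin
  Σℤ (λ j → z j * u (replace c p f j))
    ≡⟨ ℤΣ.∑-remove p (λ j → z j * u (replace c p f j)) ⟩
  z p * u (replace c p f p) + Σℤ (λ j → z (punchIn p j) * u (replace c p f (punchIn p j)))
    ≡⟨ cong₂ (λ e s → z p * u e + s) (replace-at c p f)
         (ℤΣ.∑-cong (λ j → cong (λ e → z (punchIn p j) * u e) (replace-punchIn c p f j))) ⟩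
  z p * u f + Σℤ (λ j → z (punchIn p j) * u (c (punchIn p j)))
    ≡⟨ lem (z p) (u f) (u (c p)) (Σℤ (λ j → z (punchIn p j) * u (c (punchIn p j)))) ⟩
  z p * u (c p) + Σℤ (λ j → z (punchIn p j) * u (c (punchIn p j))) + z p * (u f - u (c p))
    ≡⟨ cong (_+ z p * (u f - u (c p))) (ℤΣ.∑-remove p (λ j → z j * u (c j))) ⟨
  Σℤ (λ j → z j * u (c j)) + z p * (u f - u (c p)) ∎
  where
  open ≡-Reasoning
  lem : ∀ z f c s → z * f + s ≡ z * c + s + z * (f - c)
  lem = solve-∀

-- Row p is left as it is, so after the pivot the new basis vector is D p f times column f:
-- this keeps the row signs of Camion's theorem unchanged.
pivot : ∀ {k n} → Mat ℤ k n → Fin k → Fin n → Mat ℤ k n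
pivot D p f i e with i ≟ p
... | yes _ = D i e
... | no _  = D i e - D i f * D p f * D p e

pivot-row : ∀ {k n} (D : Mat ℤ k n) p f e → pivot D p f p e ≡ D p e
pivot-row D p f e with p ≟ p
... | yes _  = refl
... | no p≢p = contradiction refl p≢p

pivot-other : ∀ {k n} (D : Mat ℤ k n) p f {i} e → i ≢ p →
  pivot D p f i e ≡ D i e - D i f * D p f * D p e
pivot-other D p f {i} e i≢p with i ≟ p
... | yes i≡p = contradiction i≡p i≢p
... | no _    = refl

pivot-fixed : ∀ {k n} (D : Mat ℤ k n) p f {i e} → D p e ≡ 0ℤ → pivot D p f i e ≡ D i e
pivot-fixed D p f {i} {e} eq with i ≟ p
... | yes _ = refl
... | no _  = trans (cong (λ x → D i e - D i f * D p f * x) eq) (lem (D i e) (D i f) (D p f))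
  where
  lem : ∀ x y z → x - y * z * 0ℤ ≡ x
  lem = solve-∀

-- Change of basis at position `p`: `x` and `y` are the coordinates of a column and of the entering
-- column, `s` the entries of the scaled basis in one row, and the starred vectors their values
-- after the exchange. As `y p` is its own inverse, no quotient appears.
Σ-pivot : ∀ {k} (p : Fin k) (x y s x* s* : Fin k → ℤ) → y p * y p ≡ 1ℤ →
  x* p ≡ x p → s* p ≡ y p * Σℤ (λ j → y j * s j) →
  (∀ j → j ≢ p → x* j ≡ x j - y j * y p * x p) → (∀ j → j ≢ p → s* j ≡ s j) →
  Σℤ (λ j → x j * s j) ≡ Σℤ (λ j → x* j * s* j)
Σ-pivot {suc k} p x y s x* s* y²≡1 xp sp xj sj = sym (begin
  Σℤ (λ j → x* j * s* j)
    ≡⟨ ℤΣ.∑-remove p (λ j → x* j * s* j) ⟩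
  x* p * s* p + Σℤ (λ j → x* (punchIn p j) * s* (punchIn p j))
    ≡⟨ cong₂ _+_ (cong₂ _*_ xp (trans sp (cong (y p *_) (ℤΣ.∑-remove p (λ j → y j * s j))))) rest ⟩
  x p * (y p * (y p * s p + Y)) + (1ℤ * X + - (y p * x p) * Y)
    ≡⟨ lem (x p) (y p) (s p) X Y ⟩
  y p * y p * (x p * s p) + X
    ≡⟨ cong (λ t → t * (x p * s p) + X) y²≡1 ⟩
  1ℤ * (x p * s p) + X
    ≡⟨ cong (_+ X) (ℤ.*-identityˡ (x p * s p)) ⟩
  x p * s p + X
    ≡⟨ ℤΣ.∑-remove p (λ j → x j * s j) ⟨
  Σℤ (λ j → x j * s j) ∎)
  where
  open ≡-Reasoning
  X = Σℤ (λ j → x (punchIn p j) * s (punchIn p j))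
  Y = Σℤ (λ j → y (punchIn p j) * s (punchIn p j))
  lem : ∀ x y s X Y → x * (y * (y * s + Y)) + (1ℤ * X + - (y * x) * Y) ≡ y * y * (x * s) + X
  lem = solve-∀
  lem′ : ∀ x y z w → x - y * z * w ≡ 1ℤ * x + - (z * w) * y
  lem′ = solve-∀
  rest : Σℤ (λ j → x* (punchIn p j) * s* (punchIn p j)) ≡ 1ℤ * X + - (y p * x p) * Y
  rest = trans
    (ℤΣ.∑-cong (λ j → cong₂ _*_
      (trans (xj (punchIn p j) (punchInᵢ≢i p j)) (lem′ (x (punchIn p j)) (y (punchIn p j)) (y p) (x p)))
      (sj (punchIn p j) (punchInᵢ≢i p j))))
    (Σ-linear 1ℤ (- (y p * x p)) (λ j → x (punchIn p j)) (λ j → y (punchIn p j)) (λ j → s (punchIn p j)))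

-- The basis vectors are the columns `c j` with signs `σ j`; these signs absorb the factor `D p f`
-- that `pivot` puts on the entering column.
record Coordinates {g n k} (A : Mat ℤ g n) (c : Fin k → Fin n) (D : Mat ℤ k n) : Set where
  field
    independent : LinIndep A c
    σ           : Fin k → ℤ
    σ-sign      : ∀ j → IsSign (σ j)
    expand      : ∀ a e → A a e ≡ Σℤ (λ j → D j e * (σ j * A a (c j)))

module _ {g n k} {A : Mat ℤ g n} {c : Fin k → Fin n} {D : Mat ℤ k n} (C : Coordinates A c D) where
  open Coordinates C
  open ≡-Reasoning

  expand′ : ∀ a e → A a e ≡ Σℤ (λ j → D j e * σ j * A a (c j))
  expand′ a e = trans (expand a e) (ℤΣ.∑-cong (λ j → sym (ℤ.*-assoc (D j e) (σ j) (A a (c j)))))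

  coordinates-ternary : TotallyUnimodular A → ∀ j e → Ternary (D j e)
  coordinates-ternary TU j e = subst Ternary Dσσ
    (Ternary-* (span-ternary A TU c independent e (λ j → D j e * σ j) (λ a → expand′ a e) j) (inj₂ (σ-sign j)))
    where
    Dσσ : D j e * σ j * σ j ≡ D j e
    Dσσ = trans (ℤ.*-assoc (D j e) (σ j) (σ j))
      (trans (cong (D j e *_) (IsSign-square (σ-sign j))) (ℤ.*-identityʳ (D j e)))

  -- Expanding column `f` turns a relation `z` on the new family into the relation `w` on the old
  -- one. Its entry at `p` is `z p * D p f` up to sign, so `z p` vanishes, and then `w` equals `z`.
  pivot-independent : ∀ p f → D p f ≢ 0ℤ → LinIndep A (replace c p f)
  pivot-independent p f D≢0 z z∈ker j = begin
    z j                                           ≡⟨ lem (z j) (D j f * σ j) (idℤ p j) ⟩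
    z j + 0ℤ * (D j f * σ j + -1ℤ * idℤ p j)      ≡⟨ cong (λ t → z j + t * (D j f * σ j + -1ℤ * idℤ p j)) zₚ≡0 ⟨
    z j + z p * (D j f * σ j + -1ℤ * idℤ p j)     ≡⟨ lem₁ (z j) (z p) (D j f * σ j) (idℤ p j) ⟩
    w j                                           ≡⟨ w≡0 j ⟩
    0ℤ                                            ∎
    where
    lem : ∀ z x y → z ≡ z + 0ℤ * (x + -1ℤ * y)
    lem = solve-∀
    lem₁ : ∀ z t x y → z + t * (x + -1ℤ * y) ≡ 1ℤ * z + t * (1ℤ * x + -1ℤ * y)
    lem₁ = solve-∀
    lem₂ : ∀ s t f c → 1ℤ * s + t * (1ℤ * f + -1ℤ * c) ≡ s + t * (f - c)
    lem₂ = solve-∀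
    lem₃ : ∀ z d s → z * (d * s) * s ≡ z * d * (s * s)
    lem₃ = solve-∀
    lem₄ : ∀ z x → 1ℤ * z + z * (1ℤ * x + -1ℤ * 1ℤ) ≡ z * x
    lem₄ = solve-∀
    v : Fin k → ℤ
    v j = 1ℤ * (D j f * σ j) + -1ℤ * idℤ p j
    w : Fin k → ℤ
    w j = 1ℤ * z j + z p * v j
    w∈ker : w ∈ker columns A c
    w∈ker a = begin
      Σℤ (λ j → w j * A a (c j))
        ≡⟨ Σ-linear 1ℤ (z p) z v (λ j → A a (c j)) ⟩
      1ℤ * Σℤ (λ j → z j * A a (c j)) + z p * Σℤ (λ j → v j * A a (c j))
        ≡⟨ cong (λ t → 1ℤ * Σℤ (λ j → z j * A a (c j)) + z p * t)
             (trans (Σ-linear 1ℤ -1ℤ (λ j → D j f * σ j) (idℤ p) (λ j → A a (c j)))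
               (cong₂ (λ x y → 1ℤ * x + -1ℤ * y) (sym (expand′ a f)) (Σ-idℤˡ p (λ j → A a (c j))))) ⟩
      1ℤ * Σℤ (λ j → z j * A a (c j)) + z p * (1ℤ * A a f + -1ℤ * A a (c p))
        ≡⟨ lem₂ (Σℤ (λ j → z j * A a (c j))) (z p) (A a f) (A a (c p)) ⟩
      Σℤ (λ j → z j * A a (c j)) + z p * (A a f - A a (c p))
        ≡⟨ Σ-replace c p f z (A a) ⟨
      Σℤ (λ j → z j * A a (replace c p f j))
        ≡⟨ z∈ker a ⟩
      0ℤ ∎
    w≡0 : ∀ j → w j ≡ 0ℤ
    w≡0 = independent w w∈ker
    zₚ≡0 : z p ≡ 0ℤ
    zₚ≡0 = *-cancel-≢0 D≢0 (begin
      z p * D p f                                    ≡⟨ ℤ.*-identityʳ (z p * D p f) ⟨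
      z p * D p f * 1ℤ                               ≡⟨ cong (z p * D p f *_) (IsSign-square (σ-sign p)) ⟨
      z p * D p f * (σ p * σ p)                      ≡⟨ lem₃ (z p) (D p f) (σ p) ⟨
      z p * (D p f * σ p) * σ p                      ≡⟨ cong (_* σ p) (lem₄ (z p) (D p f * σ p)) ⟨
      (1ℤ * z p + z p * (1ℤ * (D p f * σ p) + -1ℤ * 1ℤ)) * σ p
        ≡⟨ cong (λ t → (1ℤ * z p + z p * (1ℤ * (D p f * σ p) + -1ℤ * t)) * σ p) (idℤ-diag p) ⟨
      w p * σ p                                      ≡⟨ cong (_* σ p) (w≡0 p) ⟩
      0ℤ                                             ∎)

  pivot-coordinates : TotallyUnimodular A → ∀ p f → D p f ≢ 0ℤ → Coordinates A (replace c p f) (pivot D p f)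
  pivot-coordinates TU p f D≢0 = record
    { independent = pivot-independent p f D≢0
    ; σ           = σ*
    ; σ-sign      = σ*-sign
    ; expand      = λ a e → trans (expand a e)
        (Σ-pivot p (λ j → D j e) (λ j → D j f) (λ j → σ j * A a (c j))
          (λ j → pivot D p f j e) (λ j → σ* j * A a (replace c p f j))
          (IsSign-square D-sign) (pivot-row D p f e)
          (cong₂ _*_ (replace-at σ p (D p f)) (trans (cong (A a) (replace-at c p f)) (expand a f)))
          (λ j j≢p → pivot-other D p f e j≢p)
          (λ j j≢p → cong₂ (λ s e → s * A a e)
            (updateAt-minimal j p σ j≢p) (updateAt-minimal j p c j≢p)))
    }
    where
    D-sign : IsSign (D p f)
    D-sign = Ternary-sign (coordinates-ternary TU p f) D≢0
    σ* : Fin k → ℤ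
    σ* = replace σ p (D p f)
    σ*-sign : ∀ j → IsSign (σ* j)
    σ*-sign j with j ≟ p
    ... | yes refl = subst IsSign (sym (replace-at σ p (D p f))) D-sign
    ... | no j≢p   = subst IsSign (sym (updateAt-minimal j p σ j≢p)) (σ-sign j)

  -- If `D p f` vanished, column `f` would be a combination of the other basis columns. Together
  -- with `pivot-independent` this shows that the matroid and the basis determine the support of
  -- `D`.
  replace-independent⇒≢0 : ∀ p f → LinIndep A (replace c p f) → D p f ≢ 0ℤ
  replace-independent⇒≢0 p f ind Dpf≡0 = contradiction (trans (sym zₚ≡1) (ind z z∈ker p)) λ ()
    where
    z : Fin k → ℤ
    z j = 1ℤ * idℤ p j + -1ℤ * (D j f * σ j)
    zₚ≡1 : z p ≡ 1ℤ
    zₚ≡1 = cong₂ (λ x y → 1ℤ * x + -1ℤ * (y * σ p)) (idℤ-diag p) Dpf≡0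
    cancel : ∀ c f → 1ℤ * c + -1ℤ * f + 1ℤ * (f - c) ≡ 0ℤ
    cancel = solve-∀
    z∈ker : z ∈ker columns A (replace c p f)
    z∈ker a = begin
      Σℤ (λ j → z j * A a (replace c p f j))
        ≡⟨ Σ-replace c p f z (A a) ⟩
      Σℤ (λ j → z j * A a (c j)) + z p * (A a f - A a (c p))
        ≡⟨ cong₂ (λ x y → x + y * (A a f - A a (c p)))
             (trans (Σ-linear 1ℤ -1ℤ (idℤ p) (λ j → D j f * σ j) (λ j → A a (c j)))
               (cong₂ (λ x y → 1ℤ * x + -1ℤ * y) (Σ-idℤˡ p (λ j → A a (c j))) (sym (expand′ a f))))
             zₚ≡1 ⟩
      1ℤ * A a (c p) + -1ℤ * A a f + 1ℤ * (A a f - A a (c p))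
        ≡⟨ cancel (A a (c p)) (A a f) ⟩
      0ℤ ∎

-- Camion's theorem

-- Connectivity of rows in the bipartite graph whose edges are the nonzero entries. As in Warshall's
-- algorithm, the head column is crossed at most once, which makes the relation decidable; `Walk` is
-- the form suited to induction on length.
Conn : ∀ {k n} → Mat ℤ k n → List (Fin n) → Fin k → Fin k → Set
Conn D []             i j = i ≡ j
Conn D (e List.∷ es) i j = Conn D es i j ⊎
  (∃ λ p → ∃ λ q → Conn D es i p × (D p e ≢ 0ℤ) × (D q e ≢ 0ℤ) × Conn D es q j)

data Walk {k n} (es : List (Fin n)) (D : Mat ℤ k n) : ℕ → Fin k → Fin k → Set where
  []   : ∀ {i} → Walk es D 0 i i
  step : ∀ {l i j j′} e → e ∈ es → D i e ≢ 0ℤ → D j e ≢ 0ℤ → Walk es D l j j′ → Walk es D (suc l) i j′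

module _ {k n} {D : Mat ℤ k n} where

  conn? : ∀ es i j → Dec (Conn D es i j)
  conn? []            i j = i ≟ j
  conn? (e List.∷ es) i j = conn? es i j ⊎-dec
    any? λ p → any? λ q → conn? es i p ×-dec ¬? (D p e ℤ.≟ 0ℤ) ×-dec ¬? (D q e ℤ.≟ 0ℤ) ×-dec conn? es q j

  conn-refl : ∀ es {i} → Conn D es i i
  conn-refl []            = refl
  conn-refl (e List.∷ es) = inj₁ (conn-refl es)

  conn-sym : ∀ es {i j} → Conn D es i j → Conn D es j i
  conn-sym []            i≡j = sym i≡j
  conn-sym (e List.∷ es) (inj₁ i~j) = inj₁ (conn-sym es i~j)
  conn-sym (e List.∷ es) (inj₂ (p , q , i~p , p≢0 , q≢0 , q~j)) =
    inj₂ (q , p , conn-sym es q~j , q≢0 , p≢0 , conn-sym es i~p)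

  conn-trans : ∀ es {i j l} → Conn D es i j → Conn D es j l → Conn D es i l
  conn-trans []            i≡j j≡l = trans i≡j j≡l
  conn-trans (e List.∷ es) (inj₁ i~j) (inj₁ j~l) = inj₁ (conn-trans es i~j j~l)
  conn-trans (e List.∷ es) (inj₁ i~j) (inj₂ (p , q , j~p , p≢0 , q≢0 , q~l)) =
    inj₂ (p , q , conn-trans es i~j j~p , p≢0 , q≢0 , q~l)
  conn-trans (e List.∷ es) (inj₂ (p , q , i~p , p≢0 , q≢0 , q~j)) (inj₁ j~l) =
    inj₂ (p , q , i~p , p≢0 , q≢0 , conn-trans es q~j j~l)
  -- Both paths cross column `e`, so everything between the two crossings is dropped.
  conn-trans (e List.∷ es) (inj₂ (p , _ , i~p , p≢0 , _)) (inj₂ (_ , q , _ , _ , q≢0 , q~l)) =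
    inj₂ (p , q , i~p , p≢0 , q≢0 , q~l)

  conn-column : ∀ {es e i j} → e ∈ es → D i e ≢ 0ℤ → D j e ≢ 0ℤ → Conn D es i j
  conn-column {e List.∷ es} (here refl)  i≢0 j≢0 = inj₂ (_ , _ , conn-refl es , i≢0 , j≢0 , conn-refl es)
  conn-column {e List.∷ es} (there e∈es) i≢0 j≢0 = inj₁ (conn-column e∈es i≢0 j≢0)

  walk-weaken : ∀ {e es l i j} → Walk es D l i j → Walk (e List.∷ es) D l i j
  walk-weaken []                     = []
  walk-weaken (step f f∈ i≢0 j≢0 w) = step f (there f∈) i≢0 j≢0 (walk-weaken w)

  walk-++ : ∀ {es l l′ i j j′} → Walk es D l i j → Walk es D l′ j j′ → Walk es D (l ℕ.+ l′) i j′
  walk-++ []                     w′ = w′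
  walk-++ (step f f∈ i≢0 j≢0 w) w′ = step f f∈ i≢0 j≢0 (walk-++ w w′)

  conn⇒walk : ∀ es {i j} → Conn D es i j → ∃ λ l → Walk es D l i j
  conn⇒walk []            refl = 0 , []
  conn⇒walk (e List.∷ es) (inj₁ i~j) = _ , walk-weaken (proj₂ (conn⇒walk es i~j))
  conn⇒walk (e List.∷ es) (inj₂ (p , q , i~p , p≢0 , q≢0 , q~j)) =
    _ , walk-++ (walk-weaken (proj₂ (conn⇒walk es i~p)))
          (step e (here refl) p≢0 q≢0 (walk-weaken (proj₂ (conn⇒walk es q~j))))

  -- Where a column of the walk meets row `q`, the walk can be entered from `q` at no extra length.
  -- If this never happens, all its columns are zero in row `q`, hence unchanged in `D*`, and the
  -- walk survives there.
  walk-bypass : ∀ {es l p j} (D* : Mat ℤ k n) (q : Fin k) → (∀ {i e} → D q e ≡ 0ℤ → D* i e ≡ D i e) →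
    Walk es D l p j → (∃ λ l′ → l′ ℕ.≤ l × Walk es D l′ q j) ⊎ Walk es D* l p j
  walk-bypass D* q fixed [] = inj₂ []
  walk-bypass D* q fixed (step e e∈ i≢0 j≢0 w) with D q e ℤ.≟ 0ℤ
  ... | no q≢0  = inj₁ (_ , ℕ.≤-refl , step e e∈ q≢0 j≢0 w)
  ... | yes q≡0 with walk-bypass D* q fixed w
  ...   | inj₁ (l′ , l′≤l , w′) = inj₁ (l′ , ℕ.m≤n⇒m≤1+n l′≤l , w′)
  ...   | inj₂ w*               = inj₂ (step e e∈
    (λ eq → i≢0 (trans (sym (fixed q≡0)) eq)) (λ eq → j≢0 (trans (sym (fixed q≡0)) eq)) w*)

module Camion {g g′ n} {A : Mat ℤ g n} {A′ : Mat ℤ g′ n}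
  (TU : TotallyUnimodular A) (TU′ : TotallyUnimodular A′)
  (to   : ∀ {k} (c : Fin k → Fin n) → LinIndep A c → LinIndep A′ c)
  (from : ∀ {k} (c : Fin k → Fin n) → LinIndep A′ c → LinIndep A c) where

  record Paired {k} (D D′ : Mat ℤ k n) : Set where
    field
      basis  : Fin k → Fin n
      coords  : Coordinates A basis D
      coords′ : Coordinates A′ basis D′

  module _ {k} {D D′ : Mat ℤ k n} (P : Paired D D′) where
    open Paired P

    ternary : ∀ j e → Ternary (D j e)
    ternary = coordinates-ternary coords TU

    ternary′ : ∀ j e → Ternary (D′ j e)
    ternary′ = coordinates-ternary coords′ TU′

    support : ∀ {j e} → D j e ≢ 0ℤ → D′ j e ≢ 0ℤ
    support {j} {e} D≢0 = replace-independent⇒≢0 coords′ j e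
      (to (replace basis j e) (pivot-independent coords j e D≢0))

    support′ : ∀ {j e} → D j e ≡ 0ℤ → D′ j e ≡ 0ℤ
    support′ {j} {e} D≡0 with D′ j e ℤ.≟ 0ℤ
    ... | yes D′≡0 = D′≡0
    ... | no D′≢0  = contradiction D≡0 (replace-independent⇒≢0 coords j e
      (from (replace basis j e) (pivot-independent coords′ j e D′≢0)))

    paired-pivot : ∀ p f → D p f ≢ 0ℤ → Paired (pivot D p f) (pivot D′ p f)
    paired-pivot p f D≢0 = record
      { basis   = replace basis p f
      ; coords  = pivot-coordinates coords TU p f D≢0
      ; coords′ = pivot-coordinates coords′ TU′ p f (support D≢0)
      }

  module _ {k} (es : List (Fin n)) (ρ : Fin k → ℤ) (ρ-sign : ∀ j → IsSign (ρ j)) where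

    Scaled : Mat ℤ k n → Mat ℤ k n → Set
    Scaled D D′ = ∀ {e} → e ∈ es → Σ ℤ λ ε → IsSign ε × (∀ j → D′ j e ≡ ρ j * ε * D j e)

    -- The signs `φ` and `ρ p` occur squared in the correction term, so the row and column signs
    -- that worked before the pivot still work after it.
    scaled-pivot : ∀ {D D′} → Scaled D D′ → ∀ p {f} → f ∈ es → Scaled (pivot D p f) (pivot D′ p f)
    scaled-pivot {D} {D′} S p {f} f∈ {e} e∈ with S f∈ | S e∈
    ... | φ , φ-sign , eqf | ε , ε-sign , eqe = ε , ε-sign , λ j → go j
      where
      open ≡-Reasoning
      lem : ∀ ρ ε φ π x y z w → ρ * ε * x - ρ * φ * y * (π * φ * z) * (π * ε * w)
        ≡ ρ * ε * (x - (φ * φ) * (π * π) * (y * z * w))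
      lem = solve-∀
      lem′ : ∀ x y → x - 1ℤ * 1ℤ * y ≡ x - y
      lem′ = solve-∀
      go : ∀ j → pivot D′ p f j e ≡ ρ j * ε * pivot D p f j e
      go j with j ≟ p
      ... | yes refl = eqe j
      ... | no _     = begin
        D′ j e - D′ j f * D′ p f * D′ p e
          ≡⟨ cong₂ _-_ (eqe j) (cong₂ _*_ (cong₂ _*_ (eqf j) (eqf p)) (eqe p)) ⟩
        ρ j * ε * D j e - ρ j * φ * D j f * (ρ p * φ * D p f) * (ρ p * ε * D p e)
          ≡⟨ lem (ρ j) ε φ (ρ p) (D j e) (D j f) (D p f) (D p e) ⟩
        ρ j * ε * (D j e - (φ * φ) * (ρ p * ρ p) * (D j f * D p f * D p e))
          ≡⟨ cong₂ (λ x y → ρ j * ε * (D j e - x * y * (D j f * D p f * D p e)))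
               (IsSign-square φ-sign) (IsSign-square (ρ-sign p)) ⟩
        ρ j * ε * (D j e - 1ℤ * 1ℤ * (D j f * D p f * D p e))
          ≡⟨ cong (ρ j * ε *_) (lem′ (D j e) (D j f * D p f * D p e)) ⟩
        ρ j * ε * (D j e - D j f * D p f * D p e) ∎

    module _ (m : Fin n) where

      -- If the entry of column `m` in row `i` is nonzero, the product `D i m * D′ i m * ρ i` is the
      -- column sign that this row demands of `m`.
      Coherent : Mat ℤ k n → Mat ℤ k n → Fin k → Fin k → Set
      Coherent D D′ i j = D i m * D′ i m * ρ i ≡ D j m * D′ j m * ρ j

      -- After the pivot at (i , e) the entries x_j - b a x_i of D and of D′ are again 0, 1 or -1,
      -- which forces x_j = b a x_i in both matrices.
      coherent-step : ∀ {D D′} → Paired D D′ → Scaled D D′ → ∀ {i j e} → e ∈ es →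
        D i e ≢ 0ℤ → D j e ≢ 0ℤ → D i m ≢ 0ℤ → D j m ≢ 0ℤ → Coherent D D′ i j
      coherent-step {D} {D′} P S {i} {j} {e} e∈ a≢0 b≢0 x≢0 y≢0 with i ≟ j | S e∈
      ... | yes refl | _ = refl
      ... | no i≢j   | ε , ε-sign , eqe = sym (begin
        D j m * D′ j m * ρ j
          ≡⟨ cong₂ (λ x y → x * y * ρ j) eqD (trans eqD′ (cong₂ (λ x y → x * y * D′ i m) (eqe j) (eqe i))) ⟩
        b * a * D i m * (ρ j * ε * b * (ρ i * ε * a) * D′ i m) * ρ j
          ≡⟨ lem a b ε (ρ i) (ρ j) (D i m) (D′ i m) ⟩
        (a * a) * (b * b) * (ε * ε) * (ρ j * ρ j) * (D i m * D′ i m * ρ i)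
          ≡⟨ cong₂ _*_ (cong₂ _*_ (cong₂ _*_ (cong₂ _*_ (IsSign-square a-sign) (IsSign-square b-sign))
               (IsSign-square ε-sign)) (IsSign-square (ρ-sign j))) refl ⟩
        1ℤ * (D i m * D′ i m * ρ i)
          ≡⟨ ℤ.*-identityˡ (D i m * D′ i m * ρ i) ⟩
        D i m * D′ i m * ρ i ∎)
        where
        open ≡-Reasoning
        a = D i e
        b = D j e
        nonzero-sign : ∀ {j e} → D j e ≢ 0ℤ → IsSign (D j e)
        nonzero-sign {j} {e} = Ternary-sign (ternary P j e)
        nonzero-sign′ : ∀ {j e} → D j e ≢ 0ℤ → IsSign (D′ j e)
        nonzero-sign′ {j} {e} ≢0 = Ternary-sign (ternary′ P j e) (support P ≢0)
        a-sign = nonzero-sign a≢0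
        b-sign = nonzero-sign b≢0
        P* = paired-pivot P i e a≢0
        j≢i : j ≢ i
        j≢i j≡i = i≢j (sym j≡i)
        eqD : D j m ≡ b * a * D i m
        eqD = IsSign-difference (nonzero-sign y≢0) (IsSign-* (IsSign-* b-sign a-sign) (nonzero-sign x≢0))
          (subst Ternary (pivot-other D i e m j≢i) (ternary P* j m))
        eqD′ : D′ j m ≡ D′ j e * D′ i e * D′ i m
        eqD′ = IsSign-difference (nonzero-sign′ y≢0)
          (IsSign-* (IsSign-* (nonzero-sign′ b≢0) (nonzero-sign′ a≢0)) (nonzero-sign′ x≢0))
          (subst Ternary (pivot-other D′ i e m j≢i) (ternary′ P* j m))
        lem : ∀ a b ε ρ π x y → b * a * x * (π * ε * b * (ρ * ε * a) * y) * π
          ≡ (a * a) * (b * b) * (ε * ε) * (π * π) * (x * y * ρ)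
        lem = solve-∀

      -- A walk i -e- q -f- p ... j of length at least 2 is split at q if column m meets row q,
      -- shortened if it has a chord at q or between p and e, and otherwise shortened by a pivot
      -- at (q , f), which does not change column m.
      coherent-walk : ∀ N {l} → l ℕ.≤ N → ∀ {D D′} → Paired D D′ → Scaled D D′ → ∀ {i j} →
        Walk es D l i j → D i m ≢ 0ℤ → D j m ≢ 0ℤ → Coherent D D′ i j
      coherent-walk N l≤N P S [] x≢0 y≢0 = refl
      coherent-walk N l≤N P S (step e e∈ i≢0 j≢0 []) x≢0 y≢0 = coherent-step P S e∈ i≢0 j≢0 x≢0 y≢0
      coherent-walk (suc N) (ℕ.s≤s l≤N) {D} {D′} P S {i} {j}
        (step {j = q} e e∈ ie≢0 qe≢0 (step {j = p} f f∈ qf≢0 pf≢0 w)) x≢0 y≢0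
        with D q m ℤ.≟ 0ℤ
      ... | no qm≢0 = trans (coherent-step P S e∈ ie≢0 qe≢0 x≢0 qm≢0)
                            (coherent-walk N l≤N P S (step f f∈ qf≢0 pf≢0 w) qm≢0 y≢0)
      ... | yes qm≡0 with D i f ℤ.≟ 0ℤ | D p e ℤ.≟ 0ℤ | walk-bypass (pivot D q f) q (pivot-fixed D q f) w
      ...   | no if≢0 | _ | _ = coherent-walk N l≤N P S (step f f∈ if≢0 pf≢0 w) x≢0 y≢0
      ...   | yes _ | no pe≢0 | _ = coherent-walk N l≤N P S (step e e∈ ie≢0 pe≢0 w) x≢0 y≢0
      -- The length `l′` is known only up to a bound, which is why the induction runs on `N` and not
      -- on the walk.
      ...   | yes _ | yes _ | inj₁ (l′ , l′≤l , w′) =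
        coherent-walk N (ℕ.≤-trans (ℕ.s≤s l′≤l) l≤N) P S (step e e∈ ie≢0 qe≢0 w′) x≢0 y≢0
      ...   | yes if≡0 | yes pe≡0 | inj₂ w* =
        trans (sym (fixed-coherent i)) (trans
          (coherent-walk N l≤N (paired-pivot P q f qf≢0) (scaled-pivot S q f∈) {i} {j}
            (step {i = i} {j = p} e e∈ ie*≢0 pe*≢0 w*) (fixed-≢0 {i} x≢0) (fixed-≢0 {j} y≢0))
          (fixed-coherent j))
        where
        fixed-≢0 : ∀ {i} → D i m ≢ 0ℤ → pivot D q f i m ≢ 0ℤ
        fixed-≢0 ≢0 eq = ≢0 (trans (sym (pivot-fixed D q f qm≡0)) eq)
        fixed-coherent : ∀ i → pivot D q f i m * pivot D′ q f i m * ρ i ≡ D i m * D′ i m * ρ i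
        fixed-coherent i = cong₂ (λ x y → x * y * ρ i)
          (pivot-fixed D q f qm≡0) (pivot-fixed D′ q f (support′ P qm≡0))
        i≢q : i ≢ q
        i≢q refl = qf≢0 if≡0
        p≢q : p ≢ q
        p≢q refl = qe≢0 pe≡0
        lem : ∀ x y z → x - 0ℤ * y * z ≡ x
        lem = solve-∀
        lem′ : ∀ x → 0ℤ - x ≡ - x
        lem′ = solve-∀
        ie*≢0 : pivot D q f i e ≢ 0ℤ
        ie*≢0 eq = ie≢0 (trans (sym (trans (pivot-other D q f e i≢q)
          (trans (cong (λ t → D i e - t * D q f * D q e) if≡0) (lem (D i e) (D q f) (D q e))))) eq)
        -- The pivot fills this entry with a product of three nonzero entries up to sign, so column
        -- `e` now joins `i` to `p` directly and `q` is skipped.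
        pe*≢0 : pivot D q f p e ≢ 0ℤ
        pe*≢0 eq = pf≢0 (*-cancel-≢0 qf≢0 (*-cancel-≢0 qe≢0 (ℤ.neg-injective (trans (sym
          (trans (pivot-other D q f e p≢q)
            (trans (cong (_- D p f * D q f * D q e) pe≡0) (lem′ (D p f * D q f * D q e))))) eq))))

  module Extend {k} {D D′ : Mat ℤ k n} (P : Paired D D′) (m : Fin n) (es : List (Fin n))
    (ρ : Fin k → ℤ) (ρ-sign : ∀ j → IsSign (ρ j)) (S : Scaled es ρ ρ-sign D D′) where

    Near : Fin k → Set
    Near j = ∃ λ p → Conn D es j p × (D p m ≢ 0ℤ)

    near? : ∀ j → Dec (Near j)
    near? j = any? λ p → conn? es j p ×-dec ¬? (D p m ℤ.≟ 0ℤ)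

    ratio : Fin k → ℤ
    ratio p = D p m * D′ p m * ρ p

    ratio-sign : ∀ {p} → D p m ≢ 0ℤ → IsSign (ratio p)
    ratio-sign {p} ≢0 = IsSign-* (IsSign-* (Ternary-sign (ternary P p m) ≢0)
      (Ternary-sign (ternary′ P p m) (support P ≢0))) (ρ-sign p)

    ratio-conn : ∀ {p q} → Conn D es p q → D p m ≢ 0ℤ → D q m ≢ 0ℤ → ratio p ≡ ratio q
    ratio-conn p~q p≢0 q≢0 with conn⇒walk es p~q
    ... | l , w = coherent-walk es ρ ρ-sign m l ℕ.≤-refl P S w p≢0 q≢0

    correction : ∀ {j} → Dec (Near j) → ℤ
    correction (yes (p , _)) = ratio p
    correction (no _)        = 1ℤ

    -- A sign constant on connected components: flipping the rows of a component by the sign they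
    -- demand of `m` leaves column `m` with sign 1. Components that miss `m` are not flipped.
    τ : Fin k → ℤ
    τ j = correction (near? j)

    τ-sign : ∀ j → IsSign (τ j)
    τ-sign j with near? j
    ... | yes (p , _ , p≢0) = ratio-sign p≢0
    ... | no _              = inj₁ refl

    τ-conn : ∀ {i j} → Conn D es i j → τ i ≡ τ j
    τ-conn {i} {j} i~j with near? i | near? j
    ... | yes (p , i~p , p≢0) | yes (q , j~q , q≢0) =
      ratio-conn (conn-trans es (conn-sym es i~p) (conn-trans es i~j j~q)) p≢0 q≢0
    ... | yes (p , i~p , p≢0) | no ¬near = contradiction (p , conn-trans es (conn-sym es i~j) i~p , p≢0) ¬near
    ... | no ¬near | yes (q , j~q , q≢0) = contradiction (q , conn-trans es i~j j~q , q≢0) ¬near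
    ... | no _ | no _ = refl

    τ-ratio : ∀ {j} → D j m ≢ 0ℤ → τ j ≡ ratio j
    τ-ratio {j} j≢0 with near? j
    ... | yes (p , j~p , p≢0) = ratio-conn (conn-sym es j~p) p≢0 j≢0
    ... | no ¬near            = contradiction (j , conn-refl es , j≢0) ¬near

    zero-column : ∀ x {j e} → D j e ≡ 0ℤ → D′ j e ≡ x * D j e
    zero-column x {j} {e} eq = trans (support′ P eq) (sym (trans (cong (x *_) eq) (ℤ.*-zeroʳ x)))

    ρ* : Fin k → ℤ
    ρ* j = ρ j * τ j

    ρ*-sign : ∀ j → IsSign (ρ* j)
    ρ*-sign j = IsSign-* (ρ-sign j) (τ-sign j)

    -- The nonzero entries of an old column lie in one component, so there `τ` is a single sign,
    -- which is compensated in the column sign. A zero column imposes no condition.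
    scaled* : Scaled (m List.∷ es) ρ* ρ*-sign D D′
    scaled* (here refl) = 1ℤ , inj₁ refl , eq
      where
      open ≡-Reasoning
      lem : ∀ ρ x y → ρ * (x * y * ρ) * 1ℤ * x ≡ (ρ * ρ) * (x * x) * y
      lem = solve-∀
      eq : ∀ j → D′ j m ≡ ρ j * τ j * 1ℤ * D j m
      eq j with D j m ℤ.≟ 0ℤ
      ... | yes ≡0 = zero-column (ρ j * τ j * 1ℤ) ≡0
      ... | no ≢0  = sym (begin
        ρ j * τ j * 1ℤ * D j m
          ≡⟨ cong (λ t → ρ j * t * 1ℤ * D j m) (τ-ratio ≢0) ⟩
        ρ j * (D j m * D′ j m * ρ j) * 1ℤ * D j m
          ≡⟨ lem (ρ j) (D j m) (D′ j m) ⟩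
        (ρ j * ρ j) * (D j m * D j m) * D′ j m
          ≡⟨ cong₂ (λ x y → x * y * D′ j m) (IsSign-square (ρ-sign j))
               (IsSign-square (Ternary-sign (ternary P j m) ≢0)) ⟩
        1ℤ * D′ j m
          ≡⟨ ℤ.*-identityˡ (D′ j m) ⟩
        D′ j m ∎)
    scaled* {e} (there e∈) with S e∈ | any? (λ i → ¬? (D i e ℤ.≟ 0ℤ))
    ... | ε , ε-sign , eq | no ¬nz = 1ℤ , inj₁ refl , λ j → zero-column (ρ* j * 1ℤ) (zero-entry j)
      where
      zero-entry : ∀ j → D j e ≡ 0ℤ
      zero-entry j with D j e ℤ.≟ 0ℤ
      ... | yes ≡0 = ≡0
      ... | no ≢0  = contradiction (j , ≢0) ¬nz
    ... | ε , ε-sign , eq | yes (i , i≢0) = ε * τ i , IsSign-* ε-sign (τ-sign i) , eq*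
      where
      open ≡-Reasoning
      lem : ∀ ρ τ ε x → ρ * τ * (ε * τ) * x ≡ (τ * τ) * (ρ * ε * x)
      lem = solve-∀
      eq* : ∀ j → D′ j e ≡ ρ j * τ j * (ε * τ i) * D j e
      eq* j with D j e ℤ.≟ 0ℤ
      ... | yes ≡0 = zero-column (ρ j * τ j * (ε * τ i)) ≡0
      ... | no ≢0  = sym (begin
        ρ j * τ j * (ε * τ i) * D j e
          ≡⟨ cong (λ t → ρ j * τ j * (ε * t) * D j e) (τ-conn (conn-column e∈ i≢0 ≢0)) ⟩
        ρ j * τ j * (ε * τ j) * D j e
          ≡⟨ lem (ρ j) (τ j) ε (D j e) ⟩
        (τ j * τ j) * (ρ j * ε * D j e)
          ≡⟨ cong₂ _*_ (IsSign-square (τ-sign j)) (sym (eq j)) ⟩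
        1ℤ * D′ j e
          ≡⟨ ℤ.*-identityˡ (D′ j e) ⟩
        D′ j e ∎)

  camion : ∀ {k} {D D′ : Mat ℤ k n} → Paired D D′ → ∀ es →
    Σ (Fin k → ℤ) λ ρ → Σ (∀ j → IsSign (ρ j)) λ ρ-sign → Scaled es ρ ρ-sign D D′
  camion P [] = (λ _ → 1ℤ) , (λ _ → inj₁ refl) , λ ()
  camion P (m List.∷ es) with camion P es
  ... | ρ , ρ-sign , S = ρ* , ρ*-sign , scaled*
    where open Extend P m es ρ ρ-sign S

-- Invertible integer matrices

extend-to-permutation : ∀ {k g} (r r′ : Fin k → Fin g) → Injective _≡_ _≡_ r → Injective _≡_ _≡_ r′ →
  Σ (Permutation′ g) λ σ → ∀ i → σ ⟨$⟩ʳ r i ≡ r′ i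
extend-to-permutation {zero}  r r′ inj inj′ = Perm.id , λ ()
extend-to-permutation {suc k} r r′ inj inj′
  with extend-to-permutation (r ∘ suc) (r′ ∘ suc) (suc-injective ∘ inj) (suc-injective ∘ inj′)
-- Neither of the two transposed points is one of the targets `r′ (suc i)`, so the values already
-- arranged are undisturbed.
... | σ , eq = σ ∘ₚ transpose (σ ⟨$⟩ʳ r zero) (r′ zero) , extended
  where
  extended : ∀ i → Components.transpose (σ ⟨$⟩ʳ r zero) (r′ zero) (σ ⟨$⟩ʳ r i) ≡ r′ i
  extended zero with (σ ⟨$⟩ʳ r zero) ≟ (σ ⟨$⟩ʳ r zero)
  ... | yes _ = refl
  ... | no ≢  = contradiction refl ≢
  extended (suc i) with (σ ⟨$⟩ʳ r (suc i)) ≟ (σ ⟨$⟩ʳ r zero)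
  ... | yes ≡ = contradiction (inj (trans (sym (inverseˡ σ)) (trans (cong (σ ⟨$⟩ˡ_) ≡) (inverseˡ σ)))) λ ()
  ... | no _ with (σ ⟨$⟩ʳ r (suc i)) ≟ r′ zero
  ...   | yes ≡ = contradiction (inj′ (trans (sym (eq i)) ≡)) λ ()
  ...   | no _  = eq i

Σ-assoc : ∀ {m n} (x : Fin m → ℤ) (N : Mat ℤ m n) (y : Fin n → ℤ) →
  Σℤ (λ l → x l * Σℤ (λ j → N l j * y j)) ≡ Σℤ (λ j → Σℤ (λ l → x l * N l j) * y j)
Σ-assoc x N y = begin
  Σℤ (λ l → x l * Σℤ (λ j → N l j * y j))
    ≡⟨ ℤΣ.∑-cong (λ l → trans (ℤΣ.*-distribˡ-∑ (x l) (λ j → N l j * y j))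
         (ℤΣ.∑-cong (λ j → sym (ℤ.*-assoc (x l) (N l j) (y j))))) ⟩
  Σℤ (λ l → Σℤ (λ j → x l * N l j * y j))
    ≡⟨ ℤΣ.∑-comm (λ l j → x l * N l j * y j) ⟩
  Σℤ (λ j → Σℤ (λ l → x l * N l j * y j))
    ≡⟨ ℤΣ.∑-cong (λ j → ℤΣ.*-distribʳ-∑ (y j) (λ l → x l * N l j)) ⟨
  Σℤ (λ j → Σℤ (λ l → x l * N l j) * y j) ∎
  where open ≡-Reasoning

Inverses : ∀ {k} → Mat ℤ k k → Mat ℤ k k → Set
Inverses X Y = (∀ i j → (X ·ℤ Y) i j ≡ idℤ i j) × (∀ i j → (Y ·ℤ X) i j ≡ idℤ i j)

unimodular-inverse : ∀ {k} (P : Mat ℤ k k) → IsSign (det P) → GLℤ P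
unimodular-inverse {k} P sign = Y , PY , YP
  where
  open ≡-Reasoning
  d = det P
  d²≡1 : d * d ≡ 1ℤ
  d²≡1 = IsSign-square sign
  d≢0 : d ≢ 0ℤ
  d≢0 d≡0 = contradiction (trans (sym (cong (λ x → x * x) d≡0)) d²≡1) λ ()
  -- Cramer's rule for P y = eᵢ
  N : Fin k → Mat ℤ k (suc k)
  N i a = idℤ a i ∷ P a
  -- The kernel vector of `N i` begins with `d`. Since `d * d` is 1, the factor `- d` turns that
  -- entry into -1, and the remaining entries solve the system.
  Y : Mat ℤ k k
  Y j i = - d * cofactor (N i) (suc j)
  PY : ∀ a i → (P ·ℤ Y) a i ≡ idℤ a i
  PY a i = begin
    Σℤ (λ j → P a j * (- d * cofactor (N i) (suc j)))
      ≡⟨ ℤΣ.∑-cong (λ j → lem (P a j) d (cofactor (N i) (suc j))) ⟩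
    Σℤ (λ j → - d * (cofactor (N i) (suc j) * P a j))
      ≡⟨ ℤΣ.*-distribˡ-∑ (- d) (λ j → cofactor (N i) (suc j) * P a j) ⟨
    - d * Σℤ (λ j → cofactor (N i) (suc j) * P a j)
      ≡⟨ lem′ d (idℤ a i) (Σℤ (λ j → cofactor (N i) (suc j) * P a j)) ⟩
    d * d * idℤ a i - d * (1ℤ * d * idℤ a i + Σℤ (λ j → cofactor (N i) (suc j) * P a j))
      ≡⟨ cong₂ (λ x y → x * idℤ a i - d * y) d²≡1 (cofactor-kernel (N i) a) ⟩
    1ℤ * idℤ a i - d * 0ℤ
      ≡⟨ lem″ d (idℤ a i) ⟩
    idℤ a i ∎
    where
    lem : ∀ p d z → p * (- d * z) ≡ - d * (z * p)
    lem = solve-∀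
    lem′ : ∀ d i s → - d * s ≡ d * d * i - d * (1ℤ * d * i + s)
    lem′ = solve-∀
    lem″ : ∀ d i → 1ℤ * i - d * 0ℤ ≡ i
    lem″ = solve-∀
  YP : ∀ i j → (Y ·ℤ P) i j ≡ idℤ i j
  -- Because `Y` is a right inverse, `P` kills each column of `Y ·ℤ P` minus the identity, and the
  -- kernel of `P` is trivial.
  YP i j = ℤ.i-j≡0⇒i≡j ((Y ·ℤ P) i j) (idℤ i j) (trans (lem ((Y ·ℤ P) i j) (idℤ i j)) (det-kernel P d≢0 w w∈ker i))
    where
    lem : ∀ x y → x - y ≡ 1ℤ * x + -1ℤ * y
    lem = solve-∀
    w : Fin k → ℤ
    w i = 1ℤ * (Y ·ℤ P) i j + -1ℤ * idℤ i j
    cancel : ∀ x → 1ℤ * x + -1ℤ * x ≡ 0ℤ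
    cancel = solve-∀
    w∈ker : w ∈ker P
    w∈ker a = begin
      Σℤ (λ i → w i * P a i)
        ≡⟨ Σ-linear 1ℤ -1ℤ (λ i → (Y ·ℤ P) i j) (λ i → idℤ i j) (P a) ⟩
      1ℤ * Σℤ (λ i → (Y ·ℤ P) i j * P a i) + -1ℤ * Σℤ (λ i → idℤ i j * P a i)
        ≡⟨ cong₂ (λ x y → 1ℤ * x + -1ℤ * y)
             (trans (ℤΣ.∑-cong (λ i → ℤ.*-comm ((Y ·ℤ P) i j) (P a i)))
               (trans (Σ-assoc (P a) Y (λ l → P l j))
                 (trans (ℤΣ.∑-cong (λ l → cong (_* P l j) (PY a l))) (Σ-idℤˡ a (λ l → P l j)))))
             (trans (ℤΣ.∑-cong (λ i → ℤ.*-comm (idℤ i j) (P a i))) (Σ-idℤʳ j (P a))) ⟩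
      1ℤ * P a j + -1ℤ * P a j
        ≡⟨ cancel (P a j) ⟩
      0ℤ ∎

-- T = Pσ + (F′ - Pσ F) L, where L = Y (restriction to the rows r) is a left inverse of F and Pσ the
-- matrix of a permutation of the coordinates that moves the rows r to the rows r′.
module Transport {g k} (F F′ : Mat ℤ g k) (r r′ : Fin k → Fin g) (Y Y′ : Mat ℤ k k)
  (inv : Inverses (λ i j → F (r i) j) Y) (inv′ : Inverses (λ i j → F′ (r′ i) j) Y′)
  (σ : Permutation′ g) (σr : ∀ i → σ ⟨$⟩ʳ r i ≡ r′ i) where
  open ≡-Reasoning

  L : (Fin g → ℤ) → Fin k → ℤ
  L y j = Σℤ (λ l → Y j l * y (r l))

  L′ : (Fin g → ℤ) → Fin k → ℤ
  L′ y j = Σℤ (λ l → Y′ j l * y (r′ l))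

  K : Mat ℤ g k
  K a j = 1ℤ * F′ a j + -1ℤ * F (σ ⟨$⟩ˡ a) j

  T : (Fin g → ℤ) → Fin g → ℤ
  T y a = y (σ ⟨$⟩ˡ a) + Σℤ (λ j → K a j * L y j)

  T-expand : ∀ y a → T y a ≡
    y (σ ⟨$⟩ˡ a) + (1ℤ * Σℤ (λ j → F′ a j * L y j) + -1ℤ * Σℤ (λ j → F (σ ⟨$⟩ˡ a) j * L y j))
  T-expand y a = cong (y (σ ⟨$⟩ˡ a) +_) (Σ-linear 1ℤ -1ℤ (F′ a) (F (σ ⟨$⟩ˡ a)) (L y))

  F-L : ∀ y i → Σℤ (λ j → F (r i) j * L y j) ≡ y (r i)
  F-L y i = trans (Σ-assoc (F (r i)) Y (λ l → y (r l)))
    (trans (ℤΣ.∑-cong (λ l → cong (_* y (r l)) (proj₁ inv i l))) (Σ-idℤˡ i (λ l → y (r l))))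

  T-rows : ∀ y i → T y (r′ i) ≡ Σℤ (λ j → F′ (r′ i) j * L y j)
  T-rows y i = begin
    T y (r′ i)
      ≡⟨ T-expand y (r′ i) ⟩
    y (σ ⟨$⟩ˡ r′ i) + (1ℤ * S + -1ℤ * Σℤ (λ j → F (σ ⟨$⟩ˡ r′ i) j * L y j))
      ≡⟨ cong (λ a → y a + (1ℤ * S + -1ℤ * Σℤ (λ j → F a j * L y j)))
           (trans (cong (σ ⟨$⟩ˡ_) (sym (σr i))) (inverseˡ σ)) ⟩
    y (r i) + (1ℤ * S + -1ℤ * Σℤ (λ j → F (r i) j * L y j))
      ≡⟨ cong (λ t → y (r i) + (1ℤ * S + -1ℤ * t)) (F-L y i) ⟩
    y (r i) + (1ℤ * S + -1ℤ * y (r i))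
      ≡⟨ lem (y (r i)) S ⟩
    S ∎
    where
    S = Σℤ (λ j → F′ (r′ i) j * L y j)
    lem : ∀ y s → y + (1ℤ * s + -1ℤ * y) ≡ s
    lem = solve-∀

  -- On the rows `r′` the permuted part of `T y` cancels, leaving `F′` applied to `L y`, which `Y′`
  -- inverts. Preservation of coordinates is what makes the reverse transport an inverse.
  L′-T : ∀ y j → L′ (T y) j ≡ L y j
  L′-T y j = begin
    Σℤ (λ l → Y′ j l * T y (r′ l))
      ≡⟨ ℤΣ.∑-cong (λ l → cong (Y′ j l *_) (T-rows y l)) ⟩
    Σℤ (λ l → Y′ j l * Σℤ (λ i → F′ (r′ l) i * L y i))
      ≡⟨ Σ-assoc (Y′ j) (λ l i → F′ (r′ l) i) (L y) ⟩
    Σℤ (λ i → Σℤ (λ l → Y′ j l * F′ (r′ l) i) * L y i)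
      ≡⟨ ℤΣ.∑-cong (λ i → cong (_* L y i) (proj₂ inv′ j i)) ⟩
    Σℤ (λ i → idℤ j i * L y i)
      ≡⟨ Σ-idℤˡ j (L y) ⟩
    L y j ∎

  T-F : ∀ d a → T (λ b → Σℤ (λ j → F b j * d j)) a ≡ Σℤ (λ j → F′ a j * d j)
  T-F d a = begin
    T Fd a
      ≡⟨ T-expand Fd a ⟩
    Fd (σ ⟨$⟩ˡ a) + (1ℤ * Σℤ (λ j → F′ a j * L Fd j) + -1ℤ * Σℤ (λ j → F (σ ⟨$⟩ˡ a) j * L Fd j))
      ≡⟨ cong₂ (λ x y → Fd (σ ⟨$⟩ˡ a) + (1ℤ * x + -1ℤ * y))
           (ℤΣ.∑-cong (λ j → cong (F′ a j *_) (L-F j)))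
           (ℤΣ.∑-cong (λ j → cong (F (σ ⟨$⟩ˡ a) j *_) (L-F j))) ⟩
    Fd (σ ⟨$⟩ˡ a) + (1ℤ * Σℤ (λ j → F′ a j * d j) + -1ℤ * Fd (σ ⟨$⟩ˡ a))
      ≡⟨ lem (Fd (σ ⟨$⟩ˡ a)) (Σℤ (λ j → F′ a j * d j)) ⟩
    Σℤ (λ j → F′ a j * d j) ∎
    where
    Fd : Fin g → ℤ
    Fd b = Σℤ (λ j → F b j * d j)
    L-F : ∀ i → L Fd i ≡ d i
    L-F i = trans (Σ-assoc (Y i) (λ l → F (r l)) d)
      (trans (ℤΣ.∑-cong (λ j → cong (_* d j) (proj₂ inv i j))) (Σ-idℤˡ i d))
    lem : ∀ y s → y + (1ℤ * s + -1ℤ * y) ≡ s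
    lem = solve-∀

  -- Rows are the images of the unit vectors: the transpose of this matrix acts as `T`, just as
  -- `congr` acts on columns through the transpose.
  matrix : Mat ℤ g g
  matrix b = T (idℤ b)

  T-matrix : ∀ y a → Σℤ (λ b → y b * matrix b a) ≡ T y a
  T-matrix y a = begin
    Σℤ (λ b → y b * (idℤ b (σ ⟨$⟩ˡ a) + Σℤ (λ j → K a j * L (idℤ b) j)))
      ≡⟨ ℤΣ.∑-cong (λ b → ℤ.*-distribˡ-+ (y b) (idℤ b (σ ⟨$⟩ˡ a)) (Σℤ (λ j → K a j * L (idℤ b) j))) ⟩
    Σℤ (λ b → y b * idℤ b (σ ⟨$⟩ˡ a) + y b * Σℤ (λ j → K a j * L (idℤ b) j))
      ≡⟨ ℤΣ.∑-distrib-+ (λ b → y b * idℤ b (σ ⟨$⟩ˡ a)) (λ b → y b * Σℤ (λ j → K a j * L (idℤ b) j)) ⟩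
    Σℤ (λ b → y b * idℤ b (σ ⟨$⟩ˡ a)) + Σℤ (λ b → y b * Σℤ (λ j → K a j * L (idℤ b) j))
      ≡⟨ cong₂ _+_ (Σ-idℤʳ (σ ⟨$⟩ˡ a) y) linear ⟩
    T y a ∎
    where
    L-linear : ∀ j → Σℤ (λ b → y b * L (idℤ b) j) ≡ L y j
    L-linear j = begin
      Σℤ (λ b → y b * Σℤ (λ l → Y j l * idℤ b (r l)))
        ≡⟨ ℤΣ.∑-cong (λ b → cong (y b *_) (ℤΣ.∑-cong (λ l → ℤ.*-comm (Y j l) (idℤ b (r l))))) ⟩
      Σℤ (λ b → y b * Σℤ (λ l → idℤ b (r l) * Y j l))
        ≡⟨ Σ-assoc y (λ b l → idℤ b (r l)) (Y j) ⟩
      Σℤ (λ l → Σℤ (λ b → y b * idℤ b (r l)) * Y j l)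
        ≡⟨ ℤΣ.∑-cong (λ l → trans (cong (_* Y j l) (Σ-idℤʳ (r l) y)) (ℤ.*-comm (y (r l)) (Y j l))) ⟩
      L y j ∎
    linear : Σℤ (λ b → y b * Σℤ (λ j → K a j * L (idℤ b) j)) ≡ Σℤ (λ j → K a j * L y j)
    linear = begin
      Σℤ (λ b → y b * Σℤ (λ j → K a j * L (idℤ b) j))
        ≡⟨ ℤΣ.∑-cong (λ b → cong (y b *_) (ℤΣ.∑-cong (λ j → ℤ.*-comm (K a j) (L (idℤ b) j)))) ⟩
      Σℤ (λ b → y b * Σℤ (λ j → L (idℤ b) j * K a j))
        ≡⟨ Σ-assoc y (λ b → L (idℤ b)) (K a) ⟩
      Σℤ (λ j → Σℤ (λ b → y b * L (idℤ b) j) * K a j)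
        ≡⟨ ℤΣ.∑-cong (λ j → trans (cong (_* K a j) (L-linear j)) (ℤ.*-comm (L y j) (K a j))) ⟩
      Σℤ (λ j → K a j * L y j) ∎

module Transport-inverse {g k} (F F′ : Mat ℤ g k) (r r′ : Fin k → Fin g) (Y Y′ : Mat ℤ k k)
  (inv : Inverses (λ i j → F (r i) j) Y) (inv′ : Inverses (λ i j → F′ (r′ i) j) Y′)
  (σ : Permutation′ g) (σr : ∀ i → σ ⟨$⟩ʳ r i ≡ r′ i) where
  open ≡-Reasoning

  σ⁻¹r′ : ∀ i → flip σ ⟨$⟩ʳ r′ i ≡ r i
  σ⁻¹r′ i = trans (cong (σ ⟨$⟩ˡ_) (sym (σr i))) (inverseˡ σ)

  module T  = Transport F F′ r r′ Y Y′ inv inv′ σ σr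
  module T′ = Transport F′ F r′ r Y′ Y inv′ inv (flip σ) σ⁻¹r′

  -- By `L′-T` both transports use the coordinate vector `T.L y`, so their correction terms cancel,
  -- and so do the two permutations.
  T′-T : ∀ y b → T′.T (T.T y) b ≡ y b
  T′-T y b = begin
    T′.T (T.T y) b
      ≡⟨ T′.T-expand (T.T y) b ⟩
    T.T y (σ ⟨$⟩ʳ b) + (1ℤ * Σℤ (λ j → F b j * T.L′ (T.T y) j) + -1ℤ * Σℤ (λ j → F′ (σ ⟨$⟩ʳ b) j * T.L′ (T.T y) j))
      ≡⟨ cong₂ (λ x z → T.T y (σ ⟨$⟩ʳ b) + (1ℤ * x + -1ℤ * z))
           (ℤΣ.∑-cong (λ j → cong (F b j *_) (T.L′-T y j)))
           (ℤΣ.∑-cong (λ j → cong (F′ (σ ⟨$⟩ʳ b) j *_) (T.L′-T y j))) ⟩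
    T.T y (σ ⟨$⟩ʳ b) + (1ℤ * S + -1ℤ * S′)
      ≡⟨ cong (_+ (1ℤ * S + -1ℤ * S′)) (trans (T.T-expand y (σ ⟨$⟩ʳ b))
           (cong (λ a → y a + (1ℤ * S′ + -1ℤ * Σℤ (λ j → F a j * T.L y j))) (inverseˡ σ))) ⟩
    y b + (1ℤ * S′ + -1ℤ * S) + (1ℤ * S + -1ℤ * S′)
      ≡⟨ lem (y b) S S′ ⟩
    y b ∎
    where
    S  = Σℤ (λ j → F b j * T.L y j)
    S′ = Σℤ (λ j → F′ (σ ⟨$⟩ʳ b) j * T.L y j)
    lem : ∀ y s t → y + (1ℤ * t + -1ℤ * s) + (1ℤ * s + -1ℤ * t) ≡ y
    lem = solve-∀

  matrix-inverse : ∀ i j → (T.matrix ·ℤ T′.matrix) i j ≡ idℤ i j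
  matrix-inverse i j = trans (T′.T-matrix (T.T (idℤ i)) j) (T′-T (idℤ i) j)

-- Uniqueness of totally unimodular representations

spanning-coordinates : ∀ {g n k} (A : Mat ℤ g n) (c : Fin k → Fin n) → LinIndep A c →
  (span : ∀ e → InSpan A c e) → Coordinates A c (λ j e → proj₁ (span e) j)
spanning-coordinates A c ind span = record
  { independent = ind
  ; σ           = λ _ → 1ℤ
  ; σ-sign      = λ _ → inj₁ refl
  ; expand      = λ a e → trans (proj₂ (span e) a)
      (ℤΣ.∑-cong (λ j → cong (proj₁ (span e) j *_) (sym (ℤ.*-identityˡ (A a (c j))))))
  }

spanned-dependent : ∀ {g n k} (A : Mat ℤ g n) (c : Fin k → Fin n) e → InSpan A c e → ¬ LinIndep A (e ∷ c)
spanned-dependent A c e (x , eq) ind = contradiction (ind (-1ℤ ∷ x)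
  (λ a → trans (cong (-1ℤ * A a e +_) (sym (eq a))) (lem (A a e))) zero) λ ()
  where
  lem : ∀ v → -1ℤ * v + v ≡ 0ℤ
  lem = solve-∀

Inverses-signed : ∀ {k} (P Y : Mat ℤ k k) (ρ : Fin k → ℤ) → (∀ j → IsSign (ρ j)) → Inverses P Y →
  Inverses (λ i j → ρ j * P i j) (λ j l → ρ j * Y j l)
Inverses-signed P Y ρ ρ-sign (PY , YP) =
  (λ i l → trans (ℤΣ.∑-cong (λ j → trans (lem (ρ j) (P i j) (Y j l))
    (trans (cong (_* (P i j * Y j l)) (IsSign-square (ρ-sign j))) (ℤ.*-identityˡ (P i j * Y j l)))))
    (PY i l)) ,
  λ i j → trans (ℤΣ.∑-cong (λ l → lem′ (ρ i) (ρ j) (Y i l) (P l j)))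
    (trans (sym (ℤΣ.*-distribˡ-∑ (ρ i * ρ j) (λ l → Y i l * P l j)))
      (trans (cong (ρ i * ρ j *_) (YP i j)) (diagonal i j)))
  where
  lem : ∀ r p y → r * p * (r * y) ≡ (r * r) * (p * y)
  lem = solve-∀
  lem′ : ∀ r s y p → r * y * (s * p) ≡ r * s * (y * p)
  lem′ = solve-∀
  diagonal : ∀ i j → ρ i * ρ j * idℤ i j ≡ idℤ i j
  diagonal i j with i ≟ j
  ... | yes refl = cong (_* 1ℤ) (IsSign-square (ρ-sign i))
  ... | no _     = ℤ.*-zeroʳ (ρ i * ρ j)

module _ {g n k} (A A′ : Mat ℤ g n) (c : Fin k → Fin n) (D D′ : Mat ℤ k n)
  (expand  : ∀ e a → A a e ≡ Σℤ (λ j → D j e * A a (c j)))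
  (expand′ : ∀ e a → A′ a e ≡ Σℤ (λ j → D′ j e * A′ a (c j)))
  (ρ : Fin k → ℤ) (ρ-sign : ∀ j → IsSign (ρ j))
  (scaled : ∀ e → Σ ℤ λ ε → IsSign ε × (∀ j → D′ j e ≡ ρ j * ε * D j e))
  (r r′ : Fin k → Fin g) (P : GLℤ (submatrix A r c)) (P′ : GLℤ (submatrix A′ r′ c))
  (σ : Permutation′ g) (σr : ∀ i → σ ⟨$⟩ʳ r i ≡ r′ i) where

  -- The transport sends the basis column `c j` of `A` to `ρ j` times that of `A′`, hence column `e`
  -- to the combination with coefficients `ρ j * D j e`. By `scaled` these equal `ε * D′ j e`, as
  -- `ε` squares to 1.
  signed-transport : Σ (Mat ℤ g g) λ X → GLℤ X ×
    (∀ e → Σ ℤ λ ε → IsSign ε × (∀ a → Σℤ (λ b → A b e * X b a) ≡ ε * A′ a e))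
  signed-transport = T.matrix , (T′.matrix , I.matrix-inverse , I′.matrix-inverse) , images
    where
    open ≡-Reasoning
    F F′ : Mat ℤ g k
    F a j  = A a (c j)
    F′ a j = ρ j * A′ a (c j)
    Y Y′ : Mat ℤ k k
    Y = proj₁ P
    Y′ j l = ρ j * proj₁ P′ j l
    inv′ : Inverses (λ i j → F′ (r′ i) j) Y′
    inv′ = Inverses-signed (submatrix A′ r′ c) (proj₁ P′) ρ ρ-sign (proj₂ P′)
    module I = Transport-inverse F F′ r r′ Y Y′ (proj₂ P) inv′ σ σr
    module I′ = Transport-inverse F′ F r′ r Y′ Y inv′ (proj₂ P) (flip σ) I.σ⁻¹r′
    module T = Transport F F′ r r′ Y Y′ (proj₂ P) inv′ σ σr
    module T′ = Transport F′ F r′ r Y′ Y inv′ (proj₂ P) (flip σ) I.σ⁻¹r′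
    images : ∀ e → Σ ℤ λ ε → IsSign ε × (∀ a → Σℤ (λ b → A b e * T.matrix b a) ≡ ε * A′ a e)
    images e with scaled e
    ... | ε , ε-sign , eq = ε , ε-sign , λ a → begin
      Σℤ (λ b → A b e * T.matrix b a)
        ≡⟨ ℤΣ.∑-cong (λ b → cong (_* T.matrix b a) (trans (expand e b)
             (ℤΣ.∑-cong (λ j → ℤ.*-comm (D j e) (F b j))))) ⟩
      Σℤ (λ b → Σℤ (λ j → F b j * D j e) * T.matrix b a)
        ≡⟨ T.T-matrix (λ b → Σℤ (λ j → F b j * D j e)) a ⟩
      T.T (λ b → Σℤ (λ j → F b j * D j e)) a
        ≡⟨ T.T-F (λ j → D j e) a ⟩
      Σℤ (λ j → ρ j * A′ a (c j) * D j e)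
        ≡⟨ ℤΣ.∑-cong (λ j → trans (unscale (ρ j) (A′ a (c j)) (D j e))
             (cong (λ x → ε * (x * A′ a (c j))) (sym (eq j)))) ⟩
      Σℤ (λ j → ε * (D′ j e * A′ a (c j)))
        ≡⟨ ℤΣ.*-distribˡ-∑ ε (λ j → D′ j e * A′ a (c j)) ⟨
      ε * Σℤ (λ j → D′ j e * A′ a (c j))
        ≡⟨ cong (ε *_) (expand′ e a) ⟨
      ε * A′ a e ∎
      where
      lem : ∀ r ε a d → r * a * d * (ε * ε) ≡ ε * (r * ε * d * a)
      lem = solve-∀
      unscale : ∀ r a d → r * a * d ≡ ε * (r * ε * d * a)
      unscale r a d = trans (sym (trans (cong (r * a * d *_) (IsSign-square ε-sign)) (ℤ.*-identityʳ (r * a * d))))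
        (lem r ε a d)

module _ {g n} {A A′ : Mat ℤ g n}
  (TU : TotallyUnimodular A) (TU′ : TotallyUnimodular A′)
  (to   : ∀ {k} (c : Fin k → Fin n) → LinIndep A c → LinIndep A′ c)
  (from : ∀ {k} (c : Fin k → Fin n) → LinIndep A′ c → LinIndep A c) where

  private
    -- Spanning passes over by maximality: a column extending `c` independently in `A′` would do so
    -- in `A`.
    spanning′ : ∀ {k} (c : Fin k → Fin n) → LinIndep A c → (∀ e → InSpan A c e) → ∀ e → InSpan A′ c e
    spanning′ c ind span e with span-or-extend A′ TU′ c (to c ind) e
    ... | inj₁ span′ = span′
    ... | inj₂ ind′  = contradiction (from (e ∷ c) ind′) (spanned-dependent A c e (span e))

    unimodular : ∀ {k} {B : Mat ℤ g n} → TotallyUnimodular B → (c : Fin k → Fin n) (R : NonsingularRows B c) →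
      GLℤ (submatrix B (rows R) c)
    unimodular {B = B} TU c R = unimodular-inverse (submatrix B (rows R) c)
      (Ternary-sign (minor-ternary B TU (rows R) (injective R) c) (det≢0 R))

    module C = Camion {A = A} {A′} TU TU′ to from

    from-basis : ∀ {k} (c : Fin k → Fin n) (ind : LinIndep A c) →
      (span : ∀ e → InSpan A c e) (span′ : ∀ e → InSpan A′ c e) →
      NonsingularRows A c → NonsingularRows A′ c → Σ (Mat ℤ g g) λ X → GLℤ X ×
      (∀ e → Σ ℤ λ ε → IsSign ε × (∀ a → Σℤ (λ b → A b e * X b a) ≡ ε * A′ a e))
    from-basis c ind span span′ R R′
      with C.camion {D = λ j e → proj₁ (span e) j} {λ j e → proj₁ (span′ e) j} (record
        { basis   = c
        ; coords  = spanning-coordinates A c ind span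
        ; coords′ = spanning-coordinates A′ c (to c ind) span′
        }) (allFin n)
         | extend-to-permutation (rows R) (rows R′) (injective R) (injective R′)
    ... | ρ , ρ-sign , S | σ , σr = signed-transport A A′ c _ _ (λ e → proj₂ (span e)) (λ e → proj₂ (span′ e))
      ρ ρ-sign (λ e → S (∈-allFin e)) (rows R) (rows R′)
      (unimodular TU c R) (unimodular TU′ c R′) σ σr

  representation-unique : Σ (Mat ℤ g g) λ X → GLℤ X ×
    (∀ e → Σ ℤ λ ε → IsSign ε × (∀ a → Σℤ (λ b → A b e * X b a) ≡ ε * A′ a e))
  representation-unique = from-basis basis independent spanning (spanning′ basis independent spanning)
    (nonsingular-rows A basis independent) (nonsingular-rows A′ basis (to basis independent))
    where open Basis (exists-basis A TU)

-- Rational and integral independence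

-- Since `toℚ` normalises its fraction, it does not compute on open terms; arithmetic identities are
-- checked among unnormalised fractions.
toℚᵘ-toℚ : ∀ z → ℚ.toℚᵘ (toℚ z) ℚᵘ.≃ ℚᵘ.mkℚᵘ z 0
toℚᵘ-toℚ z = ℚ.toℚᵘ-fromℚᵘ (ℚᵘ.mkℚᵘ z 0)

toℚ-injective : ∀ {x y} → toℚ x ≡ toℚ y → x ≡ y
toℚ-injective {x} {y} eq = ℤ.*-cancelʳ-≡ x y 1ℤ (ℚᵘ.drop-*≡* {ℚᵘ.mkℚᵘ x 0} {ℚᵘ.mkℚᵘ y 0}
  (ℚ.fromℚᵘ-injective {ℚᵘ.mkℚᵘ x 0} {ℚᵘ.mkℚᵘ y 0} eq))

toℚ-+ : ∀ x y → toℚ (x + y) ≡ toℚ x ℚ.+ toℚ y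
toℚ-+ x y = ℚ.toℚᵘ-injective (begin
  ℚ.toℚᵘ (toℚ (x + y))                    ≈⟨ toℚᵘ-toℚ (x + y) ⟩
  ℚᵘ.mkℚᵘ (x + y) 0                       ≈⟨ ℚᵘ.*≡* (lem x y) ⟩
  ℚᵘ.mkℚᵘ x 0 ℚᵘ.+ ℚᵘ.mkℚᵘ y 0            ≈⟨ ℚᵘ.+-cong (toℚᵘ-toℚ x) (toℚᵘ-toℚ y) ⟨
  ℚ.toℚᵘ (toℚ x) ℚᵘ.+ ℚ.toℚᵘ (toℚ y)      ≈⟨ ℚ.toℚᵘ-homo-+ (toℚ x) (toℚ y) ⟨
  ℚ.toℚᵘ (toℚ x ℚ.+ toℚ y)                ∎)
  where
  open import Relation.Binary.Reasoning.Setoid ℚᵘ.≃-setoid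
  lem : ∀ x y → (x + y) * 1ℤ ≡ (x * 1ℤ + y * 1ℤ) * 1ℤ
  lem = solve-∀

toℚ-* : ∀ x y → toℚ (x * y) ≡ toℚ x ℚ.* toℚ y
toℚ-* x y = ℚ.toℚᵘ-injective (begin
  ℚ.toℚᵘ (toℚ (x * y))                    ≈⟨ toℚᵘ-toℚ (x * y) ⟩
  ℚᵘ.mkℚᵘ x 0 ℚᵘ.* ℚᵘ.mkℚᵘ y 0            ≈⟨ ℚᵘ.*-cong (toℚᵘ-toℚ x) (toℚᵘ-toℚ y) ⟨
  ℚ.toℚᵘ (toℚ x) ℚᵘ.* ℚ.toℚᵘ (toℚ y)      ≈⟨ ℚ.toℚᵘ-homo-* (toℚ x) (toℚ y) ⟨
  ℚ.toℚᵘ (toℚ x ℚ.* toℚ y)                ∎)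
  where open import Relation.Binary.Reasoning.Setoid ℚᵘ.≃-setoid

toℚ-Σ : ∀ {n} (f : Fin n → ℤ) → toℚ (Σℤ f) ≡ Σℚ (λ i → toℚ (f i))
toℚ-Σ {zero}  f = refl
toℚ-Σ {suc n} f = trans (toℚ-+ (f zero) (Σℤ (f ∘ suc))) (cong (toℚ (f zero) ℚ.+_) (toℚ-Σ (f ∘ suc)))

toℚ-dot : ∀ {n} (x y : Fin n → ℤ) → toℚ (Σℤ (λ i → x i * y i)) ≡ Σℚ (λ i → toℚ (x i) ℚ.* toℚ (y i))
toℚ-dot x y = trans (toℚ-Σ (λ i → x i * y i)) (ℚΣ.∑-cong (λ i → toℚ-* (x i) (y i)))

ℚ-cancel-≢0 : ∀ {p q} → p ≢ 0ℚ → p ℚ.* q ≡ 0ℚ → q ≡ 0ℚ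
ℚ-cancel-≢0 {p} {q} p≢0 eq = begin
  q                        ≡⟨ ℚ.*-identityˡ q ⟨
  1ℚ ℚ.* q                 ≡⟨ cong (ℚ._* q) (ℚ.*-inverseˡ p) ⟨
  ℚ.1/ p ℚ.* p ℚ.* q       ≡⟨ ℚ.*-assoc (ℚ.1/ p) p q ⟩
  ℚ.1/ p ℚ.* (p ℚ.* q)     ≡⟨ cong (ℚ.1/ p ℚ.*_) eq ⟩
  ℚ.1/ p ℚ.* 0ℚ            ≡⟨ ℚ.*-zeroʳ (ℚ.1/ p) ⟩
  0ℚ                       ∎
  where
  open ≡-Reasoning
  instance _ = ℚ.≢-nonZero p≢0

denominator-clears : ∀ p → toℚ (ℚ.↧ p) ℚ.* p ≡ toℚ (ℚ.↥ p)
denominator-clears p = ℚ.toℚᵘ-injective (begin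
  ℚ.toℚᵘ (toℚ (ℚ.↧ p) ℚ.* p)                    ≈⟨ ℚ.toℚᵘ-homo-* (toℚ (ℚ.↧ p)) p ⟩
  ℚ.toℚᵘ (toℚ (ℚ.↧ p)) ℚᵘ.* ℚ.toℚᵘ p            ≈⟨ ℚᵘ.*-congʳ (toℚᵘ-toℚ (ℚ.↧ p)) ⟩
  ℚᵘ.mkℚᵘ (ℚ.↧ p) 0 ℚᵘ.* ℚ.toℚᵘ p               ≈⟨ clear p ⟩
  ℚᵘ.mkℚᵘ (ℚ.↥ p) 0                             ≈⟨ toℚᵘ-toℚ (ℚ.↥ p) ⟨
  ℚ.toℚᵘ (toℚ (ℚ.↥ p))                          ∎)
  where
  open import Relation.Binary.Reasoning.Setoid ℚᵘ.≃-setoid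
  clear : ∀ p → ℚᵘ.mkℚᵘ (ℚ.↧ p) 0 ℚᵘ.* ℚ.toℚᵘ p ℚᵘ.≃ ℚᵘ.mkℚᵘ (ℚ.↥ p) 0
  clear (ℚ.mkℚ n d-1 _) = ℚᵘ.*≡* (trans (lem (ℤ.+ suc d-1) n)
    (cong (λ d → n * ℤ.+ d) (sym (ℕ.+-identityʳ (suc d-1)))))
    where
    lem : ∀ d n → d * n * 1ℤ ≡ n * d
    lem = solve-∀

clear-denominators : ∀ {n} (x : Fin n → ℚ) → Σ ℤ λ d → Σ (Fin n → ℤ) λ w →
  d ≢ 0ℤ × (∀ i → toℚ d ℚ.* x i ≡ toℚ (w i))
clear-denominators {zero}  x = 1ℤ , (λ ()) , (λ ()) , λ ()
clear-denominators {suc n} x with clear-denominators (x ∘ suc)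
... | d , w , d≢0 , eq = p * d , (d * ℚ.↥ x zero) ∷ (λ i → p * w i) , pd≢0 , cleared
  where
  open ≡-Reasoning
  p = ℚ.↧ x zero
  pd≢0 : p * d ≢ 0ℤ
  pd≢0 eq = contradiction (*-cancel-≢0 {d} {p} d≢0 eq) λ ()
  cleared : ∀ i → toℚ (p * d) ℚ.* x i ≡ toℚ (((d * ℚ.↥ x zero) ∷ (λ i → p * w i)) i)
  cleared zero = begin
    toℚ (p * d) ℚ.* x zero             ≡⟨ cong (λ t → toℚ t ℚ.* x zero) (ℤ.*-comm p d) ⟩
    toℚ (d * p) ℚ.* x zero             ≡⟨ cong (ℚ._* x zero) (toℚ-* d p) ⟩
    toℚ d ℚ.* toℚ p ℚ.* x zero         ≡⟨ ℚ.*-assoc (toℚ d) (toℚ p) (x zero) ⟩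
    toℚ d ℚ.* (toℚ p ℚ.* x zero)       ≡⟨ cong (toℚ d ℚ.*_) (denominator-clears (x zero)) ⟩
    toℚ d ℚ.* toℚ (ℚ.↥ x zero)         ≡⟨ toℚ-* d (ℚ.↥ x zero) ⟨
    toℚ (d * ℚ.↥ x zero)               ∎
  cleared (suc i) = begin
    toℚ (p * d) ℚ.* x (suc i)          ≡⟨ cong (ℚ._* x (suc i)) (toℚ-* p d) ⟩
    toℚ p ℚ.* toℚ d ℚ.* x (suc i)      ≡⟨ ℚ.*-assoc (toℚ p) (toℚ d) (x (suc i)) ⟩
    toℚ p ℚ.* (toℚ d ℚ.* x (suc i))    ≡⟨ cong (toℚ p ℚ.*_) (eq i) ⟩
    toℚ p ℚ.* toℚ (w i)                ≡⟨ toℚ-* p (w i) ⟨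
    toℚ (p * w i)                      ∎

Σ-image : ∀ {k n} (c : Fin k → Fin n) → Injective _≡_ _≡_ c → (f : Fin n → ℤ) →
  (∀ i → (∀ j → c j ≢ i) → f i ≡ 0ℤ) → Σℤ f ≡ Σℤ (λ j → f (c j))
Σ-image c inj f off = begin
  Σℤ f
    ≡⟨ ℤΣ.∑-cong term ⟩
  Σℤ (λ i → Σℤ (λ j → idℤ (c j) i * f i))
    ≡⟨ ℤΣ.∑-comm (λ i j → idℤ (c j) i * f i) ⟩
  Σℤ (λ j → Σℤ (λ i → idℤ (c j) i * f i))
    ≡⟨ ℤΣ.∑-cong (λ j → Σ-idℤˡ (c j) f) ⟩
  Σℤ (λ j → f (c j)) ∎
  where
  open ≡-Reasoning
  term : ∀ i → f i ≡ Σℤ (λ j → idℤ (c j) i * f i)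
  term i with any? (λ j → c j ≟ i)
  ... | yes (j , refl) = sym (trans
    (ℤΣ.∑-single j (λ l l≢j → cong (_* f (c j)) (idℤ-off (λ cₗ≡cⱼ → l≢j (inj cₗ≡cⱼ)))))
    (trans (cong (_* f (c j)) (idℤ-diag (c j))) (ℤ.*-identityˡ (f (c j)))))
  ... | no ∉ = trans (off i (λ j eq → ∉ (j , eq)))
    (sym (ℤΣ.∑-zero (λ j → cong (_* f i) (idℤ-off (λ eq → ∉ (j , eq))))))

module _ {g n k} (A : Mat ℤ g n) (c : Fin k → Fin n) (S : Fin n → Bool) where
  open ≡-Reasoning

  LinIndep⇒Independent : LinIndep A c → (∀ i → S i ≡ true → ∃ λ j → c j ≡ i) → Independent A S
  LinIndep⇒Independent ind S⊆c x x-off Σ≡0 i = ℚ-cancel-≢0 toℚd≢0 (trans (cleared i) (cong toℚ (w≡0 i)))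
    where
    d = proj₁ (clear-denominators x)
    w = proj₁ (proj₂ (clear-denominators x))
    d≢0 = proj₁ (proj₂ (proj₂ (clear-denominators x)))
    cleared = proj₂ (proj₂ (proj₂ (clear-denominators x)))
    toℚd≢0 : toℚ d ≢ 0ℚ
    toℚd≢0 eq = d≢0 (toℚ-injective eq)
    w-off : ∀ i → S i ≡ false → w i ≡ 0ℤ
    w-off i eq = toℚ-injective (trans (sym (cleared i))
      (trans (cong (toℚ d ℚ.*_) (x-off i eq)) (ℚ.*-zeroʳ (toℚ d))))
    w-∉ : ∀ i → (∀ j → c j ≢ i) → w i ≡ 0ℤ
    w-∉ i ∉ with S i in eq
    ... | false = w-off i eq
    ... | true  = contradiction (proj₂ (S⊆c i eq)) (∉ (proj₁ (S⊆c i eq)))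
    Σw≡0 : ∀ a → Σℤ (λ i → w i * A a i) ≡ 0ℤ
    Σw≡0 a = toℚ-injective (begin
      toℚ (Σℤ (λ i → w i * A a i))
        ≡⟨ toℚ-dot w (A a) ⟩
      Σℚ (λ i → toℚ (w i) ℚ.* toℚ (A a i))
        ≡⟨ ℚΣ.∑-cong (λ i → trans (cong (ℚ._* toℚ (A a i)) (sym (cleared i)))
             (ℚ.*-assoc (toℚ d) (x i) (toℚ (A a i)))) ⟩
      Σℚ (λ i → toℚ d ℚ.* (x i ℚ.* toℚ (A a i)))
        ≡⟨ ℚΣ.*-distribˡ-∑ (toℚ d) (λ i → x i ℚ.* toℚ (A a i)) ⟨
      toℚ d ℚ.* Σℚ (λ i → x i ℚ.* toℚ (A a i))
        ≡⟨ cong (toℚ d ℚ.*_) (Σ≡0 a) ⟩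
      toℚ d ℚ.* 0ℚ
        ≡⟨ ℚ.*-zeroʳ (toℚ d) ⟩
      0ℚ ∎)
    wc≡0 : ∀ j → w (c j) ≡ 0ℤ
    wc≡0 = ind (λ j → w (c j)) λ a → trans
      (sym (Σ-image c (LinIndep-injective A c ind) (λ i → w i * A a i) (λ i ∉ → cong (_* A a i) (w-∉ i ∉))))
      (Σw≡0 a)
    w≡0 : ∀ i → w i ≡ 0ℤ
    w≡0 i with S i in eq
    ... | false = w-off i eq
    ... | true  = subst (λ i → w i ≡ 0ℤ) (proj₂ (S⊆c i eq)) (wc≡0 (proj₁ (S⊆c i eq)))

  -- The relation `z` is pushed forward along `c` to a relation `x` on all columns; injectivity
  -- recovers `z j` as `x (c j)`.
  Independent⇒LinIndep : Independent A S → (∀ j → S (c j) ≡ true) → Injective _≡_ _≡_ c → LinIndep A c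
  Independent⇒LinIndep ind c⊆S inj z z∈ker j = begin
    z j
      ≡⟨ ℤ.*-identityʳ (z j) ⟨
    z j * 1ℤ
      ≡⟨ cong (z j *_) (idℤ-diag (c j)) ⟨
    z j * idℤ (c j) (c j)
      ≡⟨ ℤΣ.∑-single j (λ l l≢j → trans (cong (z l *_) (idℤ-off (λ eq → l≢j (inj eq)))) (ℤ.*-zeroʳ (z l))) ⟨
    x (c j)
      ≡⟨ toℚ-injective (ind (λ i → toℚ (x i)) (λ i eq → cong toℚ (x-off i eq)) Σ≡0 (c j)) ⟩
    0ℤ ∎
    where
    x : Fin n → ℤ
    x i = Σℤ (λ l → z l * idℤ (c l) i)
    x-off : ∀ i → S i ≡ false → x i ≡ 0ℤ
    x-off i Si≡false = ℤΣ.∑-zero λ l → trans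
      (cong (z l *_) (idℤ-off (λ cₗ≡i → contradiction (trans (sym (c⊆S l)) (trans (cong S cₗ≡i) Si≡false)) λ ())))
      (ℤ.*-zeroʳ (z l))
    Σ≡0 : ∀ a → Σℚ (λ i → toℚ (x i) ℚ.* toℚ (A a i)) ≡ 0ℚ
    Σ≡0 a = trans (sym (toℚ-dot x (A a))) (cong toℚ (begin
      Σℤ (λ i → x i * A a i)
        ≡⟨ Σ-assoc z (λ l → idℤ (c l)) (A a) ⟨
      Σℤ (λ l → z l * Σℤ (λ i → idℤ (c l) i * A a i))
        ≡⟨ ℤΣ.∑-cong (λ l → cong (z l *_) (Σ-idℤˡ (c l) (A a))) ⟩
      Σℤ (λ l → z l * A a (c l))
        ≡⟨ z∈ker a ⟩
      0ℤ ∎))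

-- Automorphisms as relabelled representations

range : ∀ {k n} → (Fin k → Fin n) → Fin n → Bool
range c i = does (any? (λ j → c j ≟ i))

range-self : ∀ {k n} (c : Fin k → Fin n) j → range c (c j) ≡ true
range-self c j = dec-true (any? (λ l → c l ≟ c j)) (j , refl)

range⊆ : ∀ {k n} (c : Fin k → Fin n) i → range c i ≡ true → ∃ λ j → c j ≡ i
range⊆ c i eq with any? (λ j → c j ≟ i)
... | yes ∈ = ∈

module _ {g n} (A : Mat ℤ g n) (π : Permutation′ n) (aut : IsAut A π) where

  permute : Mat ℤ g n
  permute a i = A a (π ⟨$⟩ʳ i)

  π-injective : ∀ {i j} → π ⟨$⟩ʳ i ≡ π ⟨$⟩ʳ j → i ≡ j
  π-injective eq = trans (sym (inverseˡ π)) (trans (cong (π ⟨$⟩ˡ_) eq) (inverseˡ π))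

  aut-LinIndep : ∀ {k} (c : Fin k → Fin n) → LinIndep A c → LinIndep permute c
  aut-LinIndep c ind = Independent⇒LinIndep A (λ j → π ⟨$⟩ʳ c j) (image π (range c))
    (Equivalence.to (aut (range c)) (LinIndep⇒Independent A c (range c) ind (range⊆ c)))
    (λ j → trans (cong (range c) (inverseˡ π)) (range-self c j))
    (λ eq → LinIndep-injective A c ind (π-injective eq))

  aut-LinIndep⁻ : ∀ {k} (c : Fin k → Fin n) → LinIndep permute c → LinIndep A c
  aut-LinIndep⁻ c ind = Independent⇒LinIndep A c (range c)
    (Equivalence.from (aut (range c))
      (LinIndep⇒Independent A (λ j → π ⟨$⟩ʳ c j) (image π (range c)) ind image⊆))
    (range-self c)
    (λ eq → LinIndep-injective permute c ind eq)
    where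
    image⊆ : ∀ i → image π (range c) i ≡ true → ∃ λ j → π ⟨$⟩ʳ c j ≡ i
    image⊆ i eq with range⊆ c (π ⟨$⟩ˡ i) eq
    ... | j , cⱼ≡ = j , trans (cong (π ⟨$⟩ʳ_) cⱼ≡) (inverseʳ π)

  aut-transport : TotallyUnimodular A → Σ (Mat ℤ g g) λ X → GLℤ X ×
    (∀ e → Σ ℤ λ ε → IsSign ε × (∀ a → Σℤ (λ b → A b e * X b a) ≡ ε * A a (π ⟨$⟩ʳ e)))
  aut-transport TU = representation-unique {A = A} {permute} TU
    (λ k r c r-inj c-inj → TU k r (λ j → π ⟨$⟩ʳ c j) r-inj (λ eq → c-inj (π-injective eq)))
    aut-LinIndep aut-LinIndep⁻

-- The action on the cone

open +-*-Solver using (_:*_; _:=_) renaming (solve to ℚ-solve)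

private
  x[yz]≡y[xz] : ∀ x y z → x ℚ.* (y ℚ.* z) ≡ y ℚ.* (x ℚ.* z)
  x[yz]≡y[xz] = ℚ-solve 3 (λ x y z → x :* (y :* z) := y :* (x :* z)) refl

  [xy]z≡x[zy] : ∀ x y z → x ℚ.* y ℚ.* z ≡ x ℚ.* (z ℚ.* y)
  [xy]z≡x[zy] = ℚ-solve 3 (λ x y z → x :* y :* z := x :* (z :* y)) refl

Σℚ-exchange : ∀ {m n} (x : Fin m → ℚ) (μ : Fin n → ℚ) (M : Fin n → Fin m → ℚ) →
  Σℚ (λ c → x c ℚ.* Σℚ (λ i → μ i ℚ.* M i c)) ≡ Σℚ (λ i → μ i ℚ.* Σℚ (λ c → x c ℚ.* M i c))
Σℚ-exchange x μ M = begin
  Σℚ (λ c → x c ℚ.* Σℚ (λ i → μ i ℚ.* M i c))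
    ≡⟨ ℚΣ.∑-cong (λ c → trans (ℚΣ.*-distribˡ-∑ (x c) (λ i → μ i ℚ.* M i c))
         (ℚΣ.∑-cong (λ i → x[yz]≡y[xz] (x c) (μ i) (M i c)))) ⟩
  Σℚ (λ c → Σℚ (λ i → μ i ℚ.* (x c ℚ.* M i c)))
    ≡⟨ ℚΣ.∑-comm (λ c i → μ i ℚ.* (x c ℚ.* M i c)) ⟩
  Σℚ (λ i → Σℚ (λ c → μ i ℚ.* (x c ℚ.* M i c)))
    ≡⟨ ℚΣ.∑-cong (λ i → ℚΣ.*-distribˡ-∑ (μ i) (λ c → x c ℚ.* M i c)) ⟨
  Σℚ (λ i → μ i ℚ.* Σℚ (λ c → x c ℚ.* M i c)) ∎
  where open ≡-Reasoning

congr-Σ : ∀ {g n} (X : Mat ℤ g g) (Q : Mat ℚ g g) (μ : Fin n → ℚ) (R : Fin n → Mat ℚ g g) →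
  (∀ c d → Q c d ≡ Σℚ (λ i → μ i ℚ.* R i c d)) →
  ∀ a b → congr X Q a b ≡ Σℚ (λ i → μ i ℚ.* congr X (R i) a b)
congr-Σ X Q μ R eq a b = begin
  Σℚ (λ d → Σℚ (λ c → x c ℚ.* Q c d) ℚ.* y d)
    ≡⟨ ℚΣ.∑-cong (λ d → trans (cong (ℚ._* y d) (trans
         (ℚΣ.∑-cong (λ c → cong (x c ℚ.*_) (eq c d))) (Σℚ-exchange x μ (λ i c → R i c d))))
         (ℚ.*-comm (Σℚ (λ i → μ i ℚ.* xR i d)) (y d))) ⟩
  Σℚ (λ d → y d ℚ.* Σℚ (λ i → μ i ℚ.* xR i d))
    ≡⟨ Σℚ-exchange y μ xR ⟩
  Σℚ (λ i → μ i ℚ.* Σℚ (λ d → y d ℚ.* xR i d))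
    ≡⟨ ℚΣ.∑-cong (λ i → cong (μ i ℚ.*_) (ℚΣ.∑-cong (λ d → ℚ.*-comm (y d) (xR i d)))) ⟩
  Σℚ (λ i → μ i ℚ.* Σℚ (λ d → xR i d ℚ.* y d)) ∎
  where
  open ≡-Reasoning
  x y : Fin _ → ℚ
  x c = toℚ (X c a)
  y d = toℚ (X d b)
  xR : Fin _ → Fin _ → ℚ
  xR i d = Σℚ (λ c → x c ℚ.* R i c d)

transposed-image : ∀ {g n} → Mat ℤ g g → Mat ℤ g n → Fin n → Fin g → ℚ
transposed-image X A i a = Σℚ (λ c → toℚ (X c a) ℚ.* toℚ (A c i))

congr-rankOne : ∀ {g n} (X : Mat ℤ g g) (A : Mat ℤ g n) i a b →
  congr X (rankOne A i) a b ≡ transposed-image X A i a ℚ.* transposed-image X A i b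
congr-rankOne X A i a b = begin
  Σℚ (λ d → Σℚ (λ c → x c ℚ.* (v c ℚ.* v d)) ℚ.* y d)
    ≡⟨ ℚΣ.∑-cong (λ d → trans (cong (ℚ._* y d) (trans
         (ℚΣ.∑-cong (λ c → sym (ℚ.*-assoc (x c) (v c) (v d))))
         (sym (ℚΣ.*-distribʳ-∑ (v d) (λ c → x c ℚ.* v c)))))
         ([xy]z≡x[zy] (Σℚ (λ c → x c ℚ.* v c)) (v d) (y d))) ⟩
  Σℚ (λ d → Σℚ (λ c → x c ℚ.* v c) ℚ.* (y d ℚ.* v d))
    ≡⟨ ℚΣ.*-distribˡ-∑ (Σℚ (λ c → x c ℚ.* v c)) (λ d → y d ℚ.* v d) ⟨
  Σℚ (λ c → x c ℚ.* v c) ℚ.* Σℚ (λ d → y d ℚ.* v d) ∎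
  where
  open ≡-Reasoning
  x y v : Fin _ → ℚ
  x c = toℚ (X c a)
  y d = toℚ (X d b)
  v c = toℚ (A c i)

-- The sign enters squared, so a signed permutation of columns becomes a permutation of the rank-one
-- matrices themselves.
signed-image⇒congr : ∀ {g n} (X : Mat ℤ g g) (A : Mat ℤ g n) i j {ε} → IsSign ε →
  (∀ a → Σℤ (λ b → A b i * X b a) ≡ ε * A a j) → ∀ a b → congr X (rankOne A i) a b ≡ rankOne A j a b
signed-image⇒congr X A i j {ε} ε-sign eq a b = begin
  congr X (rankOne A i) a b
    ≡⟨ congr-rankOne X A i a b ⟩
  transposed-image X A i a ℚ.* transposed-image X A i b
    ≡⟨ cong₂ ℚ._*_ (im a) (im b) ⟩
  toℚ (ε * A a j) ℚ.* toℚ (ε * A b j)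
    ≡⟨ toℚ-* (ε * A a j) (ε * A b j) ⟨
  toℚ (ε * A a j * (ε * A b j))
    ≡⟨ cong toℚ (trans (lem ε (A a j) (A b j))
         (trans (cong (_* (A a j * A b j)) (IsSign-square ε-sign)) (ℤ.*-identityˡ (A a j * A b j)))) ⟩
  toℚ (A a j * A b j)
    ≡⟨ toℚ-* (A a j) (A b j) ⟩
  rankOne A j a b ∎
  where
  open ≡-Reasoning
  lem : ∀ ε x y → ε * x * (ε * y) ≡ ε * ε * (x * y)
  lem = solve-∀
  im : ∀ a → transposed-image X A i a ≡ toℚ (ε * A a j)
  im a = trans (sym (toℚ-dot (λ c → X c a) (λ c → A c i)))
    (cong toℚ (trans (ℤΣ.∑-cong (λ c → ℤ.*-comm (X c a) (A c i))) (eq a)))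

module _ {g n} (A : Mat ℤ g n) (X : Mat ℤ g g) (π : Permutation′ n)
  (permutes : ∀ i a b → congr X (rankOne A i) a b ≡ rankOne A (π ⟨$⟩ʳ i) a b) where
  open ≡-Reasoning

  permutes⇒InStab : GLℤ X → InStab A X
  permutes⇒InStab gl = gl , forward , backward
    where
    forward : ∀ Q → InCone A Q → InCone A (congr X Q)
    forward Q (μ , μ>0 , eq) = (λ j → μ (π ⟨$⟩ˡ j)) , (λ j → μ>0 (π ⟨$⟩ˡ j)) , λ a b → begin
      congr X Q a b
        ≡⟨ congr-Σ X Q μ (rankOne A) eq a b ⟩
      Σℚ (λ i → μ i ℚ.* congr X (rankOne A i) a b)
        ≡⟨ ℚΣ.∑-cong (λ i → cong₂ ℚ._*_ (cong μ (sym (inverseˡ π))) (permutes i a b)) ⟩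
      Σℚ (λ i → μ (π ⟨$⟩ˡ (π ⟨$⟩ʳ i)) ℚ.* rankOne A (π ⟨$⟩ʳ i) a b)
        ≡⟨ ℚΣ.∑-permute (λ j → μ (π ⟨$⟩ˡ j) ℚ.* rankOne A j a b) π ⟨
      Σℚ (λ j → μ (π ⟨$⟩ˡ j) ℚ.* rankOne A j a b) ∎
    backward : ∀ P → InCone A P → Σ (Mat ℚ g g) λ Q → InCone A Q × (∀ a b → congr X Q a b ≡ P a b)
    backward P (μ , μ>0 , eq) = Q , ((λ i → μ (π ⟨$⟩ʳ i)) , (λ i → μ>0 (π ⟨$⟩ʳ i)) , λ a b → refl) , λ a b → begin
      congr X Q a b
        ≡⟨ congr-Σ X Q (λ i → μ (π ⟨$⟩ʳ i)) (rankOne A) (λ _ _ → refl) a b ⟩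
      Σℚ (λ i → μ (π ⟨$⟩ʳ i) ℚ.* congr X (rankOne A i) a b)
        ≡⟨ ℚΣ.∑-cong (λ i → cong (μ (π ⟨$⟩ʳ i) ℚ.*_) (permutes i a b)) ⟩
      Σℚ (λ i → μ (π ⟨$⟩ʳ i) ℚ.* rankOne A (π ⟨$⟩ʳ i) a b)
        ≡⟨ ℚΣ.∑-permute (λ j → μ j ℚ.* rankOne A j a b) π ⟨
      Σℚ (λ j → μ j ℚ.* rankOne A j a b)
        ≡⟨ eq a b ⟨
      P a b ∎
      where
      Q : Mat ℚ g g
      Q c d = Σℚ (λ i → μ (π ⟨$⟩ʳ i) ℚ.* rankOne A i c d)

  permutes⇒Realizes : Realizes A X π
  permutes⇒Realizes i = 1ℚ , ℚ.positive⁻¹ 1ℚ , λ a b →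
    trans (permutes i a b) (sym (ℚ.*-identityˡ (rankOne A (π ⟨$⟩ʳ i) a b)))

IsAut⇒InH : ∀ {g n} (A : Mat ℤ g n) → TotallyUnimodular A → ∀ π → IsAut A π → InH A π
IsAut⇒InH {g} A TU π aut = from-transport (aut-transport A π aut TU)
  where
  from-transport : (Σ (Mat ℤ g g) λ X → GLℤ X × (∀ e → Σ ℤ λ ε → IsSign ε ×
    (∀ a → Σℤ (λ b → A b e * X b a) ≡ ε * A a (π ⟨$⟩ʳ e)))) → InH A π
  from-transport (X , gl , images) = X , permutes⇒InStab A X π permutes gl , permutes⇒Realizes A X π permutes
    where
    permutes : ∀ i a b → congr X (rankOne A i) a b ≡ rankOne A (π ⟨$⟩ʳ i) a b
    permutes i = signed-image⇒congr X A i (π ⟨$⟩ʳ i) (proj₁ (proj₂ (images i))) (proj₂ (proj₂ (images i)))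

-- From rays back to independence

singleton-self : ∀ {n} (i : Fin n) → singleton i i ≡ true
singleton-self i with i ≟ i
... | yes _  = refl
... | no i≢i = contradiction refl i≢i

column-≢0 : ∀ {g n} (A : Mat ℤ g n) i → Independent A (singleton i) → ∃ λ a → A a i ≢ 0ℤ
column-≢0 {g} {n} A i ind = ∃-nonzero (λ a → A a i) λ Aᵢ≡0 →
  contradiction (trans (cong toℚ (sym (idℤ-diag i))) (ind (λ j → toℚ (idℤ i j)) off (vanish Aᵢ≡0) i)) ℚ.1≢0
  where
  off : ∀ j → singleton i j ≡ false → toℚ (idℤ i j) ≡ 0ℚ
  off j eq = cong toℚ (idℤ-off {i = i} {j} λ { refl → contradiction (trans (sym (singleton-self i)) eq) λ () })
  vanish : (∀ a → A a i ≡ 0ℤ) → ∀ a → Σℚ (λ j → toℚ (idℤ i j) ℚ.* toℚ (A a j)) ≡ 0ℚ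
  vanish Aᵢ≡0 a = trans (sym (toℚ-dot (idℤ i) (A a))) (cong toℚ (trans (Σ-idℤˡ i (A a)) (Aᵢ≡0 a)))

rank-one-proportional : ∀ {g} (w v : Fin g → ℚ) (μ : ℚ) → μ ≢ 0ℚ → (∃ λ a → v a ≢ 0ℚ) →
  (∀ a b → w a ℚ.* w b ≡ μ ℚ.* (v a ℚ.* v b)) → Σ ℚ λ δ → δ ≢ 0ℚ × (∀ b → w b ≡ δ ℚ.* v b)
rank-one-proportional w v μ μ≢0 (a , vₐ≢0) eq = δ , δ≢0 , w≡δv
  where
  open ≡-Reasoning
  wₐ≢0 : w a ≢ 0ℚ
  wₐ≢0 wₐ≡0 = vₐ≢0 (ℚ-cancel-≢0 vₐ≢0 (ℚ-cancel-≢0 μ≢0 (trans (sym (eq a a))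
    (trans (cong (ℚ._* w a) wₐ≡0) (ℚ.*-zeroˡ (w a))))))
  instance _ = ℚ.≢-nonZero wₐ≢0
  -- Row `a` of the hypothesis reads `w a * w b = μ * v a * v b`; dividing by `w a` gives this
  -- factor.
  δ : ℚ
  δ = ℚ.1/ w a ℚ.* (μ ℚ.* v a)
  δ≢0 : δ ≢ 0ℚ
  δ≢0 δ≡0 = vₐ≢0 (ℚ-cancel-≢0 μ≢0 (begin
    μ ℚ.* v a                               ≡⟨ ℚ.*-identityˡ (μ ℚ.* v a) ⟨
    1ℚ ℚ.* (μ ℚ.* v a)                      ≡⟨ cong (ℚ._* (μ ℚ.* v a)) (ℚ.*-inverseʳ (w a)) ⟨
    w a ℚ.* ℚ.1/ w a ℚ.* (μ ℚ.* v a)        ≡⟨ ℚ.*-assoc (w a) (ℚ.1/ w a) (μ ℚ.* v a) ⟩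
    w a ℚ.* δ                               ≡⟨ cong (w a ℚ.*_) δ≡0 ⟩
    w a ℚ.* 0ℚ                              ≡⟨ ℚ.*-zeroʳ (w a) ⟩
    0ℚ                                      ∎))
  w≡δv : ∀ b → w b ≡ δ ℚ.* v b
  w≡δv b = begin
    w b                                     ≡⟨ ℚ.*-identityˡ (w b) ⟨
    1ℚ ℚ.* w b                              ≡⟨ cong (ℚ._* w b) (ℚ.*-inverseˡ (w a)) ⟨
    ℚ.1/ w a ℚ.* w a ℚ.* w b                ≡⟨ ℚ.*-assoc (ℚ.1/ w a) (w a) (w b) ⟩
    ℚ.1/ w a ℚ.* (w a ℚ.* w b)              ≡⟨ cong (ℚ.1/ w a ℚ.*_) (eq a b) ⟩
    ℚ.1/ w a ℚ.* (μ ℚ.* (v a ℚ.* v b))      ≡⟨ cong (ℚ.1/ w a ℚ.*_) (ℚ.*-assoc μ (v a) (v b)) ⟨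
    ℚ.1/ w a ℚ.* (μ ℚ.* v a ℚ.* v b)        ≡⟨ ℚ.*-assoc (ℚ.1/ w a) (μ ℚ.* v a) (v b) ⟨
    δ ℚ.* v b                               ∎

GLℤ-transpose-injective : ∀ {g} (X : Mat ℤ g g) → GLℤ X → (s : Fin g → ℚ) →
  (∀ a → Σℚ (λ c → toℚ (X c a) ℚ.* s c) ≡ 0ℚ) → ∀ b → s b ≡ 0ℚ
GLℤ-transpose-injective X (Y , XY , _) s Xᵀs≡0 b = begin
  s b
    ≡⟨ ℚΣ-id b ⟨
  Σℚ (λ c → s c ℚ.* toℚ (idℤ c b))
    ≡⟨ ℚΣ.∑-cong (λ c → cong (s c ℚ.*_) (trans (cong toℚ (sym (XY c b)))
         (trans (toℚ-dot (X c) (λ a → Y a b)) (ℚΣ.∑-cong (λ a → ℚ.*-comm (toℚ (X c a)) (toℚ (Y a b))))))) ⟩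
  Σℚ (λ c → s c ℚ.* Σℚ (λ a → toℚ (Y a b) ℚ.* toℚ (X c a)))
    ≡⟨ Σℚ-exchange s (λ a → toℚ (Y a b)) (λ a c → toℚ (X c a)) ⟩
  Σℚ (λ a → toℚ (Y a b) ℚ.* Σℚ (λ c → s c ℚ.* toℚ (X c a)))
    ≡⟨ ℚΣ.∑-zero (λ a → trans (cong (toℚ (Y a b) ℚ.*_)
         (trans (ℚΣ.∑-cong (λ c → ℚ.*-comm (s c) (toℚ (X c a)))) (Xᵀs≡0 a))) (ℚ.*-zeroʳ (toℚ (Y a b)))) ⟩
  0ℚ ∎
  where
  open ≡-Reasoning
  ℚΣ-id : ∀ b → Σℚ (λ c → s c ℚ.* toℚ (idℤ c b)) ≡ s b
  ℚΣ-id b = trans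
    (ℚΣ.∑-single b (λ c c≢b → trans (cong (λ t → s c ℚ.* toℚ t) (idℤ-off c≢b)) (ℚ.*-zeroʳ (s c))))
    (trans (cong (λ t → s b ℚ.* toℚ t) (idℤ-diag b)) (ℚ.*-identityʳ (s b)))

module _ {g n} (A : Mat ℤ g n) (X : Mat ℤ g g) (gl : GLℤ X) (π : Permutation′ n) (δ : Fin n → ℚ)
  (δ≢0 : ∀ i → δ i ≢ 0ℚ)
  (scales : ∀ i a → transposed-image X A i a ≡ δ i ℚ.* toℚ (A a (π ⟨$⟩ʳ i))) where
  open ≡-Reasoning

  combination-image : ∀ (y : Fin n → ℚ) a →
    Σℚ (λ c → toℚ (X c a) ℚ.* Σℚ (λ i → y i ℚ.* toℚ (A c i))) ≡ Σℚ (λ i → y i ℚ.* δ i ℚ.* toℚ (A a (π ⟨$⟩ʳ i)))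
  combination-image y a = trans (Σℚ-exchange (λ c → toℚ (X c a)) y (λ i c → toℚ (A c i)))
    (ℚΣ.∑-cong (λ i → trans (cong (y i ℚ.*_) (scales i a)) (sym (ℚ.*-assoc (y i) (δ i) (toℚ (A a (π ⟨$⟩ʳ i)))))))

  -- The transpose of `X` carries the combination with coefficients `y i` to the one with
  -- coefficients `y i * δ i` at `π i`. Relations on `S` and on its image thus correspond: applying
  -- the map gives one direction, its injectivity the other.
  scales⇒IsAut : IsAut A π
  scales⇒IsAut S = mk⇔ to from
    where
    to : Independent A S → Independent A (image π S)
    to ind x x-off Σ≡0 j = begin
      x j                                 ≡⟨ cong x (inverseʳ π) ⟨
      x (π ⟨$⟩ʳ (π ⟨$⟩ˡ j))               ≡⟨ y-δ (π ⟨$⟩ˡ j) ⟨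
      y (π ⟨$⟩ˡ j) ℚ.* δ (π ⟨$⟩ˡ j)       ≡⟨ cong (ℚ._* δ (π ⟨$⟩ˡ j)) (y≡0 (π ⟨$⟩ˡ j)) ⟩
      0ℚ ℚ.* δ (π ⟨$⟩ˡ j)                 ≡⟨ ℚ.*-zeroˡ (δ (π ⟨$⟩ˡ j)) ⟩
      0ℚ                                  ∎
      where
      y : Fin n → ℚ
      y i = x (π ⟨$⟩ʳ i) ℚ.* (ℚ.1/ δ i) {{ℚ.≢-nonZero (δ≢0 i)}}
      y-δ : ∀ i → y i ℚ.* δ i ≡ x (π ⟨$⟩ʳ i)
      y-δ i = trans (ℚ.*-assoc (x (π ⟨$⟩ʳ i)) (ℚ.1/ δ i) (δ i))
        (trans (cong (x (π ⟨$⟩ʳ i) ℚ.*_) (ℚ.*-inverseˡ (δ i))) (ℚ.*-identityʳ (x (π ⟨$⟩ʳ i))))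
        where instance _ = ℚ.≢-nonZero (δ≢0 i)
      y-off : ∀ i → S i ≡ false → y i ≡ 0ℚ
      y-off i eq = trans (cong (ℚ._* (ℚ.1/ δ i) {{ℚ.≢-nonZero (δ≢0 i)}})
        (x-off (π ⟨$⟩ʳ i) (trans (cong S (inverseˡ π)) eq)))
        (ℚ.*-zeroˡ ((ℚ.1/ δ i) {{ℚ.≢-nonZero (δ≢0 i)}}))
      y≡0 : ∀ i → y i ≡ 0ℚ
      y≡0 = ind y y-off (GLℤ-transpose-injective X gl (λ c → Σℚ (λ i → y i ℚ.* toℚ (A c i))) λ a → begin
        Σℚ (λ c → toℚ (X c a) ℚ.* Σℚ (λ i → y i ℚ.* toℚ (A c i)))
          ≡⟨ combination-image y a ⟩
        Σℚ (λ i → y i ℚ.* δ i ℚ.* toℚ (A a (π ⟨$⟩ʳ i)))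
          ≡⟨ ℚΣ.∑-cong (λ i → cong (ℚ._* toℚ (A a (π ⟨$⟩ʳ i))) (y-δ i)) ⟩
        Σℚ (λ i → x (π ⟨$⟩ʳ i) ℚ.* toℚ (A a (π ⟨$⟩ʳ i)))
          ≡⟨ ℚΣ.∑-permute (λ j → x j ℚ.* toℚ (A a j)) π ⟨
        Σℚ (λ j → x j ℚ.* toℚ (A a j))
          ≡⟨ Σ≡0 a ⟩
        0ℚ ∎)
    from : Independent A (image π S) → Independent A S
    from ind y y-off Σ≡0 i = ℚ-cancel-≢0 (δ≢0 i) (begin
      δ i ℚ.* y i              ≡⟨ ℚ.*-comm (δ i) (y i) ⟩
      y i ℚ.* δ i              ≡⟨ cong (λ i → y i ℚ.* δ i) (inverseˡ π) ⟨
      x (π ⟨$⟩ʳ i)             ≡⟨ x≡0 (π ⟨$⟩ʳ i) ⟩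
      0ℚ                       ∎)
      where
      x : Fin n → ℚ
      x j = y (π ⟨$⟩ˡ j) ℚ.* δ (π ⟨$⟩ˡ j)
      x≡0 : ∀ j → x j ≡ 0ℚ
      x≡0 = ind x (λ j eq → trans (cong (ℚ._* δ (π ⟨$⟩ˡ j)) (y-off (π ⟨$⟩ˡ j) eq)) (ℚ.*-zeroˡ (δ (π ⟨$⟩ˡ j))))
        λ a → begin
        Σℚ (λ j → x j ℚ.* toℚ (A a j))
          ≡⟨ ℚΣ.∑-permute (λ j → x j ℚ.* toℚ (A a j)) π ⟩
        Σℚ (λ i → x (π ⟨$⟩ʳ i) ℚ.* toℚ (A a (π ⟨$⟩ʳ i)))
          ≡⟨ ℚΣ.∑-cong (λ i → cong (λ l → y l ℚ.* δ l ℚ.* toℚ (A a (π ⟨$⟩ʳ i))) (inverseˡ π)) ⟩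
        Σℚ (λ i → y i ℚ.* δ i ℚ.* toℚ (A a (π ⟨$⟩ʳ i)))
          ≡⟨ combination-image y a ⟨
        Σℚ (λ c → toℚ (X c a) ℚ.* Σℚ (λ i → y i ℚ.* toℚ (A c i)))
          ≡⟨ ℚΣ.∑-zero (λ c → trans (cong (toℚ (X c a) ℚ.*_) (Σ≡0 c)) (ℚ.*-zeroʳ (toℚ (X c a)))) ⟩
        0ℚ ∎

InH⇒IsAut : ∀ {g n} (A : Mat ℤ g n) → (∀ i → Independent A (singleton i)) → ∀ π → InH A π → IsAut A π
InH⇒IsAut {g} {n} A loopless π (X , (gl , _) , realizes) =
  scales⇒IsAut A X gl π (λ i → proj₁ (scale i)) (λ i → proj₁ (proj₂ (scale i))) (λ i → proj₂ (proj₂ (scale i)))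
  where
  scale : ∀ i → Σ ℚ λ δ → δ ≢ 0ℚ × (∀ a → transposed-image X A i a ≡ δ ℚ.* toℚ (A a (π ⟨$⟩ʳ i)))
  scale i with realizes i | column-≢0 A (π ⟨$⟩ʳ i) (loopless (π ⟨$⟩ʳ i))
  ... | μ , μ>0 , eq | a , Aₐ≢0 = rank-one-proportional (transposed-image X A i) (λ a → toℚ (A a (π ⟨$⟩ʳ i)))
    μ (λ μ≡0 → ℚ.<⇒≢ μ>0 (sym μ≡0)) (a , λ eq → Aₐ≢0 (toℚ-injective eq))
    (λ a b → trans (sym (congr-rankOne X A i a b)) (eq a b))

theorem5p10 : (g n : ℕ) (A : Mat ℤ g n) → TotallyUnimodular A → Simple A →
    GroupIso (InH A) (IsAut A)
theorem5p10 g n A TU (loopless , _) =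
  -- Both groups consist of permutations of the columns, so the isomorphism is the identity on
  -- permutations and only membership has to be transferred.
  (λ (π , π∈H) → π , InH⇒IsAut A loopless π π∈H) ,
  (λ _ _ eq → eq) ,
  (λ _ _ eq → eq) ,
  (λ (π , aut) → (π , IsAut⇒InH A TU π aut) , λ _ → refl) ,
  λ _ _ _ eq → eq
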